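{- Let $k$ be an odd integer with $k\ge 5$, and let $D$ be a strong $k$-quasi-transitive digraph with $\mathrm{diam}(D)\ge k+2$. Let $u,v\in V(D)$ satisfy $d(u,v)=k+2$, and let $P$ be a shortest $(u,v)$-path in $D$. Then $D[V(P)]$ is either a semicomplete digraph or a semicomplete bipartite digraph, and $D[V(D)\setminus V(P)]$ is either a semicomplete digraph, a semicomplete bipartite digraph, or an empty digraph.
   Context: All digraphs are finite, without loops or multiple arcs (a pair of opposite arcs is allowed). Two vertices $x,y$ are adjacent if $xy\in A(D)$ or $yx\in A(D)$. For an integer $k\ge 2$, a digraph $D$ is $k$-quasi-transitive if for every path $x_0x_1\ldots x_k$ of length $k$ in $D$, the vertices $x_0$ and $x_k$ are adjacent. $d(x,y)$ is the length of a shortest $(x,y)$-path ($\infty$ if none), and $\mathrm{diam}(D)=\max_{x,y\in V(D)} d(x,y)$. $D[S]$ denotes the subdigraph induced by $S$. A semicomplete digraph is one in which every two distinct vertices are adjacent. A semicomplete bipartite digraph is a digraph whose vertex set has a bipartition $(X,Y)$ with no arcs inside $X$ or inside $Y$ and with every vertex of $X$ adjacent to every vertex of $Y$. An empty digraph is one with no arcs. -}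

module Defs where

open import Data.Fin using (Fin; zero; suc; inject₁; fromℕ)
open import Data.Fin.Subset using (Subset; _∈_; ⁅_⁆; ⋃)
open import Data.List using (tabulate)
open import Data.Nat using (ℕ; suc; _≤_)
open import Data.Product using (Σ-syntax; ∃; ∃-syntax; _×_; proj₁)
open import Data.Sum using (_⊎_)
open import Function.Definitions using (Injective)
open import Level using (0ℓ)
open import Relation.Binary.Core using (Rel)
open import Relation.Binary.Construct.Add.Supremum.NonStrict _≤_ using (_≤⁺_)
open import Relation.Binary.Definitions using (Decidable)
open import Relation.Binary.PropositionalEquality using (_≡_; _≢_)
open import Relation.Nullary using (¬_)
open import Relation.Nullary.Construct.Add.Supremum using (_⁺; [_]; ⊤⁺)
open import Relation.Unary using (Pred; Empty; Universal; _∪_; _∩_)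

-- Finiteness is not a field: a finite digraph is a Digraph (Fin n), or an
-- induced subdigraph of one.  The vertex type is a parameter so that an induced
-- subdigraph is again a digraph.
record Digraph (V : Set) : Set₁ where
  field
    Arc    : Rel V 0ℓ
    arc?   : Decidable Arc
    noLoop : ∀ x → ¬ Arc x x

open Digraph public

Adjacent : {V : Set} → Digraph V → Rel V 0ℓ
Adjacent D x y = Arc D x y ⊎ Arc D y x

record Path {V : Set} (D : Digraph V) (x y : V) : Set where
  field
    length   : ℕ
    vertex   : Fin (suc length) → V
    distinct : Injective _≡_ _≡_ vertex
    start    : vertex zero ≡ x
    end      : vertex (fromℕ length) ≡ y
    arcs     : ∀ (i : Fin length) → Arc D (vertex (inject₁ i)) (vertex (suc i))

open Path public

Shortest : {V : Set} {D : Digraph V} {x y : V} → Path D x y → Set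
Shortest {D = D} {x} {y} P = ∀ (Q : Path D x y) → length P ≤ length Q

Strong : {V : Set} → Digraph V → Set
Strong D = ∀ x y → Path D x y

QuasiTransitive : {V : Set} → ℕ → Digraph V → Set
QuasiTransitive k D = ∀ x y (P : Path D x y) → length P ≡ k → Adjacent D x y

-- IsDistance D x y d says that d(x,y) = d, where ⊤⁺ stands for ∞.
IsDistance : {V : Set} → Digraph V → V → V → ℕ ⁺ → Set
IsDistance D x y [ m ] = Σ[ P ∈ Path D x y ] (length P ≡ m × Shortest P)
IsDistance D x y ⊤⁺    = ¬ Path D x y

IsDiameter : {V : Set} → Digraph V → ℕ ⁺ → Set
IsDiameter D δ =
  (∃[ x ] ∃[ y ] IsDistance D x y δ) ×
  (∀ x y d → IsDistance D x y d → d ≤⁺ δ)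

vertices : ∀ {n} {D : Digraph (Fin n)} {x y : Fin n} → Path D x y → Subset n
vertices P = ⋃ (tabulate (λ i → ⁅ vertex P i ⁆))

-- Membership x ∈ S has at most one proof, so distinct elements of the vertex
-- type below have distinct underlying vertices.
_⟨_⟩ : ∀ {n} → Digraph (Fin n) → (S : Subset n) → Digraph (∃ λ x → x ∈ S)
D ⟨ S ⟩ = record
  { Arc    = λ x y → Arc D (proj₁ x) (proj₁ y)
  ; arc?   = λ x y → arc? D (proj₁ x) (proj₁ y)
  ; noLoop = λ x → noLoop D (proj₁ x)
  }

Semicomplete : {V : Set} → Digraph V → Set
Semicomplete D = ∀ x y → x ≢ y → Adjacent D x y

record SemicompleteBipartite {V : Set} (D : Digraph V) : Set₁ where
  field
    X Y      : Pred V 0ℓ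
    cover    : Universal (X ∪ Y)
    disjoint : Empty (X ∩ Y)
    noArcX   : ∀ x x′ → X x → X x′ → ¬ Arc D x x′
    noArcY   : ∀ y y′ → Y y → Y y′ → ¬ Arc D y y′
    across   : ∀ x y → X x → Y y → Adjacent D x y

EmptyDigraph : {V : Set} → Digraph V → Set
EmptyDigraph D = ∀ x y → ¬ Arc D x y

{-# OPTIONS --safe #-}
-- Write k = 5 + 2h and P = x 0, ..., x (7 + 2h).  No shortcut of P exists, so a path of length k
-- inside P whose end lies below its start forces a back arc.  Cycling around P this way yields every
-- back arc between indices of different parity, and a single back arc between indices of equal
-- parity then yields all of them; hence P induces a semicomplete or a semicomplete bipartite digraph.
-- A vertex outside P that is reached from P is coloured by the parity of its neighbours in P, and
-- two outside vertices of different colours are adjacent: either a path of length k through P joins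
-- them, or both are dominated by P, or both dominate P, and then one inducts along a path between
-- P and one of them.  If P has no back arc between indices of equal parity, every outside vertex
-- has only one colour and no arc joins vertices of the same colour, so the outside is semicomplete
-- bipartite (with an empty class in the case of an empty digraph); otherwise every outside vertex
-- has both colours, so the outside is semicomplete.
module Submission where

open import Defs hiding (start; end)
open import Data.Empty using (⊥; ⊥-elim)
open import Data.Fin as Fin using (Fin; inject₁; fromℕ; fromℕ<; toℕ)
open import Data.Fin.Properties using (toℕ-injective; toℕ-fromℕ<; toℕ-fromℕ; toℕ-inject₁; toℕ≤pred[n])
open import Data.Fin.Subset using (Subset; ⁅_⁆; ∁; ⋃) renaming (_∈_ to _∈ₛ_)
open import Data.Fin.Subset.Properties using (x∈p∪q⁻; p⊆p∪q; q⊆p∪q; x∈⁅x⁆; x∈⁅y⁆⇒x≡y; x∈∁p⇒x∉p; ∉⊥)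
open import Data.List as List using (List; []; _∷_; _++_; lookup)
open import Data.List.Properties using (length-++)
open import Data.List.Membership.Propositional using (_∈_)
open import Data.List.Membership.Propositional.Properties using (∈-lookup)
open import Data.List.Relation.Unary.All as All using (All)
import Data.List.Relation.Unary.All.Properties as All
import Data.List.Relation.Unary.AllPairs as AllPairs
open import Data.List.Relation.Unary.Any using (here; there)
open import Data.List.Relation.Unary.Unique.Propositional using (Unique)
import Data.List.Relation.Unary.Unique.Propositional.Properties as Unique
open import Data.Nat
open import Data.Nat.DivMod using (_%_; [m+kn]%n≡m%n)
open import Data.Nat.Induction using (<-wellFounded)
open import Data.Nat.Properties
open import Data.Nat.Solver using (module +-*-Solver)
open import Data.Parity.Base as ℙ using (Parity; 0ℙ; 1ℙ)
open import Data.Parity.Properties using (+-homo-+) renaming (+-assoc to ℙ+-assoc)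
open import Data.Product using (Σ; ∃; _×_; _,_; proj₁; proj₂)
open import Data.Sum using (_⊎_; inj₁; inj₂; swap)
open import Data.Vec.Properties.WithK using ([]=-irrelevant)
open import Function using (_∘_; flip; _∋_)
open import Induction.WellFounded using (Acc; acc)
open import Level using (0ℓ)
open import Relation.Binary.Construct.Add.Supremum.NonStrict _≤_ using (_≤⁺_)
open import Relation.Binary.Core using (Rel)
open import Relation.Binary.Definitions using (Decidable; DecidableEquality; tri<; tri≈; tri>)
open import Relation.Binary.PropositionalEquality hiding ([_])
open import Relation.Nullary using (¬_; Dec; yes; no; contradiction)
open import Relation.Nullary.Construct.Add.Supremum using (_⁺; [_])
open import Relation.Nullary.Decidable using (_×-dec_)
open import Relation.Unary using (Pred; _∪_; _⊆_)
open +-*-Solver using (solve; _:=_; _:+_; _:*_; con)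

-- P has k + 3 vertices, an even number, so the back arc from its last to its first vertex closes it
-- to an even cycle. Hence index parity alternates all around that cycle, and parity is a usable
-- colour even where P turns out to be semicomplete. The obstacle is that quasi-transitivity yields
-- an adjacency without a direction. Between vertices of P the direction follows because P has no
-- shortcut. Between P and an outside vertex it follows only when the two indices concerned are at
-- least three apart; for indices of equal parity that differ by two, the direction stays open. Two
-- outside vertices are joined through P by an arc into P, k - 2 arcs in P and an arc out of P, and
-- the open directions are what makes this a case analysis. When the arcs between P and both
-- vertices point the same way, no path through P can join them. Strong connectivity then has to be
-- used, through paths outside P of unknown length. These are cut down by k - 1 arcs at a time, an
-- even number, so that colours are respected.

module Trails {V : Set} (_⟶_ : Rel V 0ℓ) where

  open import Data.List.Relation.Unary.All using ([]; _∷_)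
  open import Data.List.Relation.Unary.AllPairs using ([]; _∷_)

  data Trail (a : V) : List V → V → Set where
    []  : Trail a [] a
    _∷_ : ∀ {b c vs} → a ⟶ b → Trail b vs c → Trail a (b ∷ vs) c

  -- `M` bounds the vertex set only from above. Simplicity of a concatenation thus reduces to the
  -- disjointness of two predicates, and no vertex lists are compared.
  record SPath (a b : V) (ℓ : ℕ) (M : Pred V 0ℓ) : Set where
    constructor spath
    field
      {rest} : List V
      trail  : Trail a rest b
      unique : Unique (a ∷ rest)
      size   : List.length rest ≡ ℓ
      inside : All M (a ∷ rest)

  abstract

    append : ∀ {a b c d vs ws} → Trail a vs b → b ⟶ c → Trail c ws d → Trail a (vs ++ c ∷ ws) d
    append []      r t = r ∷ t
    append (s ∷ u) r t = s ∷ append u r t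

    point : ∀ a → SPath a a 0 (_≡ a)
    point a = spath [] ([] ∷ []) refl (refl ∷ [])

    join : ∀ {a b c d ℓ ℓ′ M M′} → SPath a b ℓ M → b ⟶ c → SPath c d ℓ′ M′ →
           (∀ {v} → M v → M′ v → ⊥) → SPath a d (ℓ + suc ℓ′) (M ∪ M′)
    join (spath {vs} t u refl m) r (spath {ws} t′ u′ refl m′) disj = spath
      (append t r t′)
      (Unique.++⁺ u u′ λ (v∈ , v∈′) → disj (All.lookup m v∈) (All.lookup m′ v∈′))
      (length-++ vs)
      (All.++⁺ (All.map inj₁ m) (All.map inj₂ m′))

    weaken : ∀ {a b ℓ M M′} → M ⊆ M′ → SPath a b ℓ M → SPath a b ℓ M′
    weaken sub (spath t u s m) = spath t u s (All.map sub m)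

    resize : ∀ {a b ℓ ℓ′ M} → ℓ ≡ ℓ′ → SPath a b ℓ M → SPath a b ℓ′ M
    resize refl p = p

  record Between (f : ℕ → V) (i j : ℕ) (v : V) : Set where
    constructor at
    field
      index : ℕ
      lower : i ≤ index
      upper : index ≤ j
      value : v ≡ f index

  abstract

    segment : ∀ f i r → (∀ l → i ≤ l → l < i + r → f l ⟶ f (suc l)) →
              (∀ l m → i ≤ l → l < m → m ≤ i + r → f l ≢ f m) →
              SPath (f i) (f (i + r)) r (Between f i (i + r))
    segment f i zero    arc inj rewrite +-identityʳ i = weaken (at i ≤-refl ≤-refl) (point (f i))
    segment f i (suc r) arc inj rewrite +-suc i r = resize (+-comm r 1) (weaken
      (λ { (inj₁ (at l i≤l l≤ e)) → at l i≤l (m≤n⇒m≤1+n l≤) e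
         ; (inj₂ e) → at (suc (i + r)) (m≤n⇒m≤1+n (m≤m+n i r)) ≤-refl e })
      (join (segment f i r (λ l i≤ l< → arc l i≤ (m≤n⇒m≤1+n l<))
                           (λ l m i≤ l<m m≤ → inj l m i≤ l<m (m≤n⇒m≤1+n m≤)))
            (arc (i + r) (m≤m+n i r) ≤-refl) (point (f (suc (i + r))))
            λ { (at l i≤l l≤ e) e′ → inj l _ i≤l (s≤s l≤) ≤-refl (trans (sym e) e′) }))

module _ {V : Set} {_⟶_ : Rel V 0ℓ} where

  open import Data.List.Relation.Unary.All using ([]; _∷_)
  open import Data.List.Relation.Unary.AllPairs using ([]; _∷_)

  open Trails

  abstract

    -- The induction must know that `a` is absent from the reversed tail, which a mere upper bound
    -- on the vertices cannot tell; hence the exact list serves as predicate. `reversePath` recovers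
    -- `M` from it.
    reverseTrail : ∀ {a vs b} → Trail _⟶_ a vs b → Unique (a ∷ vs) →
                   SPath (flip _⟶_) b a (List.length vs) (_∈ (a ∷ vs))
    reverseTrail {a} []  u = weaken _ here (point _ a)
    reverseTrail {a} {v ∷ vs} (r ∷ t) (a∉ ∷ u) = resize _ (+-comm (List.length vs) 1) (weaken _
      (λ { (inj₁ v∈) → there v∈ ; (inj₂ e) → here e })
      (join _ (reverseTrail t u) r (point _ a) λ { v∈ refl → All.lookup a∉ v∈ refl }))

    reversePath : ∀ {a b ℓ M} → SPath _⟶_ a b ℓ M → SPath (flip _⟶_) b a ℓ M
    reversePath (spath t u refl m) = weaken _ (All.lookup m) (reverseTrail t u)

lookup-unique : ∀ {V : Set} {vs : List V} → Unique vs → ∀ i j → lookup vs i ≡ lookup vs j → i ≡ j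
lookup-unique (_ AllPairs.∷ _)  Fin.zero    Fin.zero    _ = refl
lookup-unique (v∉ AllPairs.∷ _) Fin.zero    (Fin.suc j) e = contradiction e (All.lookup v∉ (∈-lookup j))
lookup-unique (v∉ AllPairs.∷ _) (Fin.suc i) Fin.zero    e = contradiction (sym e) (All.lookup v∉ (∈-lookup i))
lookup-unique (_ AllPairs.∷ u)  (Fin.suc i) (Fin.suc j) e = cong Fin.suc (lookup-unique u i j e)

module _ {V : Set} (D : Digraph V) where

  open Trails (Arc D)

  abstract

    trail-end : ∀ {a vs b} → Trail a vs b → lookup (a ∷ vs) (fromℕ (List.length vs)) ≡ b
    trail-end []      = refl
    trail-end (_ ∷ t) = trail-end t

    trail-arcs : ∀ {a vs b} → Trail a vs b → ∀ i → Arc D (lookup (a ∷ vs) (inject₁ i)) (lookup (a ∷ vs) (Fin.suc i))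
    trail-arcs (r ∷ t) Fin.zero    = r
    trail-arcs (r ∷ t) (Fin.suc i) = trail-arcs t i

    toPath : ∀ {a b ℓ M} → SPath a b ℓ M → Σ (Path D a b) λ P → length P ≡ ℓ
    toPath {a} (spath {vs} t u refl m) = record
      { length = List.length vs ; vertex = lookup (a ∷ vs) ; distinct = λ {i} {j} → lookup-unique u i j
      ; start = refl ; end = trail-end t ; arcs = trail-arcs t } , refl


-- Linear arithmetic and parity

abstract

  slack : ∀ {a b} c → a + c ≡ b → a ≤ b
  slack {a} c refl = m≤m+n a c

  -- Adding the hypothesis to the goal leaves the slack `c`, so an inequality of linear expressions
  -- becomes an identity for the ring solver. Several hypotheses are first added up by `+-mono-≤`;
  -- `balance` does the same for equations.
  linear : ∀ {a b l r} c → l ≤ r → a + r + c ≡ l + b → a ≤ b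
  linear {a} {b} {l} {r} c p e = +-cancelˡ-≤ r a b (begin
    r + a     ≡⟨ +-comm r a ⟩
    a + r     ≤⟨ m≤m+n (a + r) c ⟩
    a + r + c ≡⟨ e ⟩
    l + b     ≤⟨ +-monoˡ-≤ b p ⟩
    r + b     ∎)
    where open ≤-Reasoning

  parity-even : ∀ c → parity (2 * c) ≡ 0ℙ
  parity-even zero    = refl
  parity-even (suc c) rewrite +-suc c (c + 0) = parity-even c

  -- The sum is used instead of the difference, which avoids truncated subtraction and a distinction
  -- of which number is larger.
  same-parity : ∀ m n c → m + n ≡ 2 * c → parity m ≡ parity n
  same-parity m n c e = cancel (parity m) (parity n) (trans (sym (+-homo-+ m n)) (trans (cong parity e) (parity-even c)))
    where
    cancel : ∀ p q → p ℙ.+ q ≡ 0ℙ → p ≡ q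
    cancel 0ℙ 0ℙ _ = refl
    cancel 1ℙ 1ℙ _ = refl
    cancel 0ℙ 1ℙ ()
    cancel 1ℙ 0ℙ ()

  parity-shift : ∀ m n r c β → m + (r + n) ≡ 2 * c → parity m ℙ.+ β ≡ parity r ℙ.+ (parity n ℙ.+ β)
  parity-shift m n r c β e = trans (cong (ℙ._+ β) (trans (same-parity m (r + n) c e) (+-homo-+ r n)))
                                   (ℙ+-assoc (parity r) (parity n) β)

-- Paths that leave P

-- A path that leaves P at v and stays outside P from then on, with n + 1 vertices after v.
record Ray {V : Set} (_⟶_ : Rel V 0ℓ) (P : Pred V 0ℓ) (v : V) (n : ℕ) (y : V) : Set where
  field
    w      : ℕ → V
    first  : v ⟶ w 0
    link   : ∀ j → j < n → w j ⟶ w (suc j)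
    simple : ∀ i j → i < j → j ≤ n → w i ≢ w j
    out    : ∀ j → j ≤ n → ¬ P (w j)
    last   : w n ≡ y

-- Only paths into and out of the vertices of P are used here, not the order of P, so that the
-- results also apply to the reversed digraph.
module Exits {V : Set} (_≟_ : DecidableEquality V) (_⟶_ : Rel V 0ℓ) (h : ℕ)
  (adj : ∀ {a b M} → Trails.SPath _⟶_ a b (5 + 2 * h) M → a ⟶ b ⊎ b ⟶ a)
  (C : Parity → Pred V 0ℓ)
  (into : ∀ {β v} r → r ≤ 4 + 2 * h → C β v →
          ∃ λ u → C (parity r ℙ.+ β) u × Trails.SPath _⟶_ u v r (λ z → ∃ λ γ → C γ z))
  (from : ∀ {β v} r → r ≤ 4 + 2 * h → C β v →
          ∃ λ u → C (parity r ℙ.+ β) u × Trails.SPath _⟶_ v u r (λ z → ∃ λ γ → C γ z))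
  where

  open Trails _⟶_ using (SPath; point; join; weaken; resize; Between; at; segment)

  P : Pred V 0ℓ
  P v = ∃ λ γ → C γ v

  Adj : V → V → Set
  Adj a b = a ⟶ b ⊎ b ⟶ a

  AdjC : Parity → V → Set
  AdjC γ y = ∃ λ u → C γ u × Adj u y

  truncate : ∀ {v n y} (R : Ray _⟶_ P v n y) j → j ≤ n → Ray _⟶_ P v j (Ray.w R j)
  truncate R j j≤n = record
    { w = w ; first = first ; link = λ i i<j → link i (<-≤-trans i<j j≤n)
    ; simple = λ i l i<l l≤j → simple i l i<l (≤-trans l≤j j≤n)
    ; out = λ i i≤j → out i (≤-trans i≤j j≤n) ; last = refl }
    where open Ray R

  extend : ∀ {v n y z} (R : Ray _⟶_ P v n y) → y ⟶ z → ¬ P z → (∀ j → j ≤ n → Ray.w R j ≢ z) →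
           Ray _⟶_ P v (suc n) z
  extend {v} {n} {y} {z} R y⟶z z∉P fresh = record
    { w = w′ ; first = subst (v ⟶_) (sym (old 0 z≤n)) first ; link = step′ ; simple = inj′ ; out = out′ ; last = new }
    where
    open Ray R
    w′ : ℕ → V
    w′ j with j ≤? n
    ... | yes _ = w j
    ... | no  _ = z
    old : ∀ j → j ≤ n → w′ j ≡ w j
    old j j≤n with j ≤? n
    ... | yes _  = refl
    ... | no j≰n = contradiction j≤n j≰n
    new : w′ (suc n) ≡ z
    new with suc n ≤? n
    ... | yes p = contradiction p 1+n≰n
    ... | no  _ = refl
    step′ : ∀ j → j < suc n → w′ j ⟶ w′ (suc j)
    step′ j (s≤s j≤n) with m≤n⇒m<n∨m≡n j≤n
    ... | inj₁ j<n  = subst₂ _⟶_ (sym (old j j≤n)) (sym (old (suc j) j<n)) (link j j<n)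
    ... | inj₂ refl = subst₂ _⟶_ (sym (trans (old j j≤n) last)) (sym new) y⟶z
    inj′ : ∀ i j → i < j → j ≤ suc n → w′ i ≢ w′ j
    inj′ i j i<j j≤ e with m≤n⇒m<n∨m≡n j≤
    ... | inj₁ (s≤s j≤n) = simple i j i<j j≤n
                             (trans (sym (old i (≤-trans (<⇒≤ i<j) j≤n))) (trans e (old j j≤n)))
    ... | inj₂ refl      = fresh i (s≤s⁻¹ i<j) (trans (sym (old i (s≤s⁻¹ i<j))) (trans e new))
    out′ : ∀ j → j ≤ suc n → ¬ P (w′ j)
    out′ j j≤ with m≤n⇒m<n∨m≡n j≤
    ... | inj₁ (s≤s j≤n) = subst (¬_ ∘ P) (sym (old j j≤n)) (out j j≤n)
    ... | inj₂ refl      = subst (¬_ ∘ P) (sym new) z∉P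

  extendAt : ∀ {v n y z} (R : Ray _⟶_ P v n y) j → j ≤ n → Ray.w R j ⟶ z → ¬ P z →
             (∀ i → i ≤ j → Ray.w R i ≢ z) → Ray _⟶_ P v (suc j) z
  extendAt R j j≤n = extend (truncate R j j≤n)

  abstract

    -- The `r` arcs inside P are padding: they bring a short ray to length k, or to k - 1 when
    -- another arc is still to be put in front.
    exitPath : ∀ {v n y β} (R : Ray _⟶_ P v n y) → C β v → ∀ r → r ≤ 4 + 2 * h → ∀ j → j ≤ n →
               ∃ λ u → C (parity r ℙ.+ β) u ×
                       SPath u (Ray.w R j) (r + suc j) (P ∪ Between (Ray.w R) 0 j)
    exitPath R Cv r r≤ j j≤n with into r r≤ Cv
    ... | u , Cu , p = u , Cu , join p first
        (segment w 0 j (λ l _ l<j → link l (<-≤-trans l<j j≤n)) (λ l m _ l<m m≤j → simple l m l<m (≤-trans m≤j j≤n)))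
        λ { z∈P (at l _ l≤j refl) → out l (≤-trans l≤j j≤n) z∈P }
      where open Ray R

    raySegment : ∀ {v n y} (R : Ray _⟶_ P v n y) i r → i + r ≤ n →
                 SPath (Ray.w R i) (Ray.w R (i + r)) r (Between (Ray.w R) i (i + r))
    raySegment R i r ≤n = segment w i r (λ l _ l< → link l (<-≤-trans l< ≤n))
                                        (λ l m _ l<m m≤ → simple l m l<m (≤-trans m≤ ≤n))
      where open Ray R

    between-out : ∀ {v n y i j} (R : Ray _⟶_ P v n y) → j ≤ n → ∀ {z} → Between (Ray.w R) i j z → ¬ P z
    between-out R j≤n (at l _ l≤j refl) = Ray.out R l (≤-trans l≤j j≤n)

    -- A short ray is padded to length k inside P. On a long one, `y` is adjacent to the vertex
    -- `w j` that precedes it by k arcs. An arc from `w j` shortens the ray by k - 1, which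
    -- preserves the parity; an arc to `w j` leads back to P by way of `w (suc j)`, to which the
    -- induction applies.
    adjacent-to-P : ∀ {v n y β} → Ray _⟶_ P v n y → C β v → AdjC (parity n ℙ.+ β) y
    adjacent-to-P {n = n} = go (<-wellFounded n)
      where
      go : ∀ {v n y β} → Acc _<_ n → Ray _⟶_ P v n y → C β v → AdjC (parity n ℙ.+ β) y
      go {v} {n} {y} {β} (acc rs) R Cv with n ≤? 4 + 2 * h
      ... | yes n≤ with m≤n⇒∃[o]m+o≡n n≤
      ...   | r , n+r with exitPath R Cv r (≤-trans (m≤n+m r n) (≤-reflexive n+r)) n ≤-refl
      ...     | u , Cu , p = u
              , subst (λ q → C (q ℙ.+ β) u) (same-parity r n (2 + h) (trans (+-comm r n) (trans n+r
                  (solve 1 (λ h → con 4 :+ con 2 :* h := con 2 :* (con 2 :+ h)) refl h)))) Cu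
              , subst (Adj u) (Ray.last R) (adj (resize (trans (+-suc r n) (cong suc (trans (+-comm r n) n+r))) p))
      go {v} {n} {y} {β} (acc rs) R Cv | no n≰ with m≤n⇒∃[o]m+o≡n (≰⇒> n≰)
      ... | j , refl = helper (subst (Adj (w j)) (trans (cong w (+-comm j (5 + 2 * h))) last)
                                (adj (raySegment R j (5 + 2 * h) (≤-reflexive (+-comm j (5 + 2 * h))))))
        where
        open Ray R
        j<n : suc j ≤ n
        j<n = slack (4 + 2 * h)
            (solve 2 (λ j h → con 1 :+ (j :+ (con 4 :+ con 2 :* h)) := con 5 :+ (con 2 :* h :+ j)) refl j h)
        y∉P : ¬ P y
        y∉P = subst (¬_ ∘ P) last (out n ≤-refl)
        par : parity (suc j) ≡ parity n
        par = same-parity (suc j) n (3 + h + j)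
            (solve 2 (λ j h → con 1 :+ (j :+ (con 5 :+ (con 2 :* h :+ j))) := con 2 :* (con 3 :+ (h :+ j))) refl j h)
        colour : ∀ r c u → r + suc j + n ≡ 2 * c → C (parity r ℙ.+ (parity (suc j) ℙ.+ β)) u → C (parity n ℙ.+ β) u
        colour r c u e = subst (λ q → C q u) (sym (parity-shift n (suc j) r c β (trans (+-comm n _) e)))
        final : ∀ i → i ≤ j → w i ≢ y
        final i i≤j e = simple i n (≤-trans (s≤s i≤j) j<n) ≤-refl (trans e (sym last))
        helper : Adj (w j) y → AdjC (parity n ℙ.+ β) y
        helper (inj₁ wj⟶y) = subst (λ q → AdjC (q ℙ.+ β) y) par
          (go (rs {suc j} (s≤s (slack (3 + 2 * h)
              (solve 2 (λ j h → con 1 :+ (j :+ (con 3 :+ con 2 :* h)) := con 4 :+ (con 2 :* h :+ j)) refl j h)))) (extendAt R j (<⇒≤ j<n) wj⟶y y∉P final) Cv)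
        helper (inj₂ y⟶wj) with go (rs {suc j} (s≤s (slack (3 + 2 * h)
            (solve 2 (λ j h → con 1 :+ (j :+ (con 3 :+ con 2 :* h)) := con 4 :+ (con 2 :* h :+ j)) refl j h)))) (truncate R (suc j) j<n) Cv
        ... | u , Cu , inj₁ u⟶w = u , subst (λ q → C (q ℙ.+ β) u) par Cu
            , subst (Adj u) (trans (cong w eq) last)
                (adj (join (point u) u⟶w (raySegment R (suc j) (4 + 2 * h) (≤-reflexive eq))
                     λ { refl b → between-out R (≤-reflexive eq) b (_ , Cu) }))
          where
          eq : suc j + (4 + 2 * h) ≡ n
          eq = solve 2 (λ j h → con 1 :+ (j :+ (con 4 :+ con 2 :* h)) := con 5 :+ (con 2 :* h :+ j)) refl j h
        -- `y ⟶ w j ⟶ w (suc j) ⟶ u` has three arcs, so k - 3 arcs inside P complete a path of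
        -- length k.
        ... | u , Cu , inj₂ w⟶u with from (2 + 2 * h) (slack 2
            (solve 1 (λ h → con 2 :+ (con 2 :* h :+ con 2) := con 4 :+ con 2 :* h) refl h)) Cu
        ...   | u′ , Cu′ , p = u′ , colour (2 + 2 * h) (4 + 2 * h + j) u′
            (solve 2 (λ j h → con 2 :+ (con 2 :* h :+ (con 1 :+ j) :+ (con 5 :+ (con 2 :* h :+ j))) := con 2 :* (con 4 :+ (con 2 :* h :+ j))) refl j h) Cu′
              , swap (adj (join (point y) y⟶wj
                  (join (join (point (w j)) (link j j<n) (point (w (suc j))) (λ { refl e → simple j (suc j) ≤-refl j<n e })) w⟶u p
                    λ { (inj₁ refl) q → out j (<⇒≤ j<n) q ; (inj₂ refl) q → out (suc j) j<n q })
                  λ { refl (inj₁ (inj₁ e)) → final j ≤-refl (sym e)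
                    ; refl (inj₁ (inj₂ e)) → simple (suc j) n (s≤s (slack (3 + 2 * h)
                        (solve 2 (λ j h → con 1 :+ (j :+ (con 3 :+ con 2 :* h)) := con 4 :+ (con 2 :* h :+ j)) refl j h))) ≤-refl (sym (trans last e))
                    ; refl (inj₂ q) → y∉P q }))

  Dominates : Parity → V → Set
  Dominates γ z = ∀ u → C γ u → z ⟶ u

  -- The class in question is opposite to the colour that the ray gives to `y`. All rays are
  -- allowed, so that the hypothesis survives a change of ray and an exchange of the two vertices.
  Exited : V → V → Set
  Exited y z = ∀ {v n β} → Ray _⟶_ P v n y → C β v → Dominates (parity (suc n) ℙ.+ β) z

  -- Along the ray, z dominates a vertex k - 1 steps before w j, hence is adjacent to w j; if
  -- w j ⟶ z, the ray to w j extends to a shorter one to z, and y and z exchange their roles.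
  abstract

    dominating-adjacent : ∀ {v n y z β} → Ray _⟶_ P v n y → C β v → y ≢ z → ¬ P y → ¬ P z →
                          Exited y z → Exited z y → Adj y z
    dominating-adjacent {n = n} = go (<-wellFounded n)
      where
      go : ∀ {v n y z β} → Acc _<_ n → Ray _⟶_ P v n y → C β v → y ≢ z → ¬ P y → ¬ P z →
           Exited y z → Exited z y → Adj y z
      go {v} {n} {y} {z} {β} (acc rs) R Cv y≢z y∉P z∉P yz zy with anyUpTo? (λ j → Ray.w R j ≟ z) (suc n)
      ... | yes (j , s≤s j≤n , refl) with m≤n⇒m<n∨m≡n j≤n
      ...   | inj₁ j<n  = swap (go (rs j<n) (truncate R j j≤n) Cv (y≢z ∘ sym) z∉P y∉P zy yz)
      ...   | inj₂ refl = contradiction (sym (Ray.last R)) y≢z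
      go {v} {n} {y} {z} {β} (acc rs) R Cv y≢z y∉P z∉P yz zy | no z∉R = finish (climb n (<-wellFounded n) 0 (+-identityʳ n))
        where
        open Ray R
        fresh : ∀ i → i ≤ n → w i ≢ z
        fresh i i≤n e = z∉R (i , s≤s i≤n , e)
        -- The equation keeps `j` at the parity of `n`. So when the k - 1 arcs before `w j` reach
        -- back into P, they start in the class that `z` dominates.
        climb : ∀ j → Acc _<_ j → ∀ c → j + 2 * c ≡ n → Adj z (w j) ⊎ Adj y z
        climb j (acc rs′) c e with j ≤? 3 + 2 * h
        ... | yes j≤ with m≤n⇒∃[o]m+o≡n j≤
        ...   | r , j+r with exitPath R Cv r (m≤n⇒m≤1+n (≤-trans (m≤n+m r j) (≤-reflexive j+r))) j (m+n≤o⇒m≤o j (≤-reflexive e))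
        ...     | u , Cu , p = inj₁ (adj (resize (cong suc (trans (+-suc r j) (cong suc (trans (+-comm r j) j+r))))
                    (join (point z) (yz R Cv u (subst (λ q → C (q ℙ.+ β) u) par Cu)) p
                      λ { refl (inj₁ q) → z∉P q
                        ; refl (inj₂ (at l _ l≤j e′)) → fresh l (≤-trans l≤j (m+n≤o⇒m≤o j (≤-reflexive e))) (sym e′) })))
          where
          eq : r + suc (j + 2 * c) ≡ (j + r) + 1 + 2 * c
          eq = solve 3 (λ r j c → r :+ (con 1 :+ (j :+ con 2 :* c)) := j :+ r :+ con 1 :+ con 2 :* c) refl r j c
          par : parity r ≡ parity (suc n)
          par = same-parity r (suc n) (2 + h + c) (trans (trans (cong (λ q → r + suc q) (sym e)) eq)
                  (trans (cong (λ q → q + 1 + 2 * c) j+r)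
                      (solve 2 (λ h c → con 3 :+ (con 2 :* h :+ con 1 :+ con 2 :* c) := con 2 :* (con 2 :+ (h :+ c))) refl h c)))
        climb j (acc rs′) c e | no j≰ with m≤n⇒∃[o]m+o≡n (≰⇒> j≰)
        ... | i , refl with climb i (rs′ (slack (3 + 2 * h)
            (solve 2 (λ i h → con 1 :+ (i :+ (con 3 :+ con 2 :* h)) := con 4 :+ (con 2 :* h :+ i)) refl i h))) (2 + h + c) (trans ((i + 2 * (2 + h + c) ≡ 4 + 2 * h + i + 2 * c) ∋ solve 3 (λ i h c → i :+ con 2 :* (con 2 :+ (h :+ c)) := con 4 :+ (con 2 :* h :+ i :+ con 2 :* c)) refl i h c) e)
        ...   | inj₂ a = inj₂ a
        ...   | inj₁ (inj₂ w⟶z) = inj₂ (swap (go (rs i<n) (extendAt R i (<⇒≤ (<⇒≤ i<n)) w⟶z z∉P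
                                      (λ l l≤i → fresh l (≤-trans l≤i (<⇒≤ (<⇒≤ i<n))))) Cv (y≢z ∘ sym) z∉P y∉P zy yz))
          where
          i<n : suc i < n
          i<n = ≤-trans {j = 4 + 2 * h + i} (slack (2 + 2 * h)
              (solve 2 (λ i h → con 2 :+ (i :+ (con 2 :+ con 2 :* h)) := con 4 :+ (con 2 :* h :+ i)) refl i h)) (m+n≤o⇒m≤o (4 + 2 * h + i) (≤-reflexive e))
        ...   | inj₁ (inj₁ z⟶w) = inj₁ (subst (Adj z) (cong w eq) (adj
                  (join (point z) z⟶w (raySegment R i (4 + 2 * h) i+≤n)
                    λ { refl (at l _ l≤ e′) → fresh l (≤-trans l≤ i+≤n) (sym e′) })))
          where
          eq : i + (4 + 2 * h) ≡ 4 + 2 * h + i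
          eq = solve 2 (λ i h → i :+ (con 4 :+ con 2 :* h) := con 4 :+ (con 2 :* h :+ i)) refl i h
          i+≤n : i + (4 + 2 * h) ≤ n
          i+≤n = ≤-trans (≤-reflexive eq) (m+n≤o⇒m≤o (4 + 2 * h + i) (≤-reflexive e))
        finish : Adj z (w n) ⊎ Adj y z → Adj y z
        finish (inj₁ a) = swap (subst (Adj z) last a)
        finish (inj₂ a) = a


abstract

  balance : ∀ {a b l r} → l ≡ r → a + r ≡ l + b → a ≡ b
  balance {a} {b} {l} refl e = +-cancelˡ-≡ l a b (trans (+-comm l a) e)

  remainder : ∀ {m n} → m ≤ n → ∃ λ r → m + r ≡ n
  remainder m≤n = m≤n⇒∃[o]m+o≡n m≤n

  -- o is the remainder of n modulo 2, and o′ = 1 - o.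
  halve : ∀ n → ∃ λ a → ∃ λ o → ∃ λ o′ → n ≡ 2 * a + o × o + o′ ≡ 1
  halve zero = 0 , 0 , 1 , refl , refl
  halve (suc n) with halve n
  ... | a , 0 , 1 , refl , _ = a , 1 , 0 , solve 1 (λ a → con 1 :+ (con 2 :* a :+ con 0) := con 2 :* a :+ con 1) refl a , refl
  ... | a , 1 , 0 , refl , _ = suc a , 0 , 1 , solve 1 (λ a → con 1 :+ (con 2 :* a :+ con 1) := con 1 :+ (a :+ (con 1 :+ (a :+ con 0)) :+ con 0)) refl a , refl
  ... | a , suc (suc o) , o′ , _ , ()

-- Back arcs inside P

module Geodesic {V : Set} (_⟶_ : Rel V 0ℓ) (h : ℕ) (x : ℕ → V)
  (step  : ∀ i → i < 7 + 2 * h → x i ⟶ x (suc i))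
  (inj   : ∀ i j → i < j → j ≤ 7 + 2 * h → x i ≢ x j)
  (adj   : ∀ {a b M} → Trails.SPath _⟶_ a b (5 + 2 * h) M → a ⟶ b ⊎ b ⟶ a)
  (short : ∀ {i j} → 2 + i ≤ j → j ≤ 7 + 2 * h → ¬ x i ⟶ x j)
  (short₂ : ∀ {i j y} → 3 + i ≤ j → j ≤ 7 + 2 * h → (∀ l → l ≤ 7 + 2 * h → x l ≢ y) → x i ⟶ y → ¬ y ⟶ x j)
  (_⟶?_ : Decidable _⟶_)
  (_≟_ : DecidableEquality V)
  (irrefl : ∀ v → ¬ v ⟶ v)
  where

  open Trails _⟶_ using (SPath; point; join; weaken; resize; Between; at; segment)

  I : ℕ → ℕ → Pred V 0ℓ
  I = Between x

  abstract

    base : ∀ {a p} s → a + s ≡ p → p ≤ 7 + 2 * h → SPath (x a) (x p) s (I a p)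
    base {a} s refl p≤ = segment x a s (λ l _ l< → step l (<-≤-trans l< p≤)) (λ l m _ l<m m≤ → inj l m l<m (≤-trans m≤ p≤))

    -- Forward arcs of the path only go one step, so a path inside P consists of segments of
    -- consecutive vertices, each one below all the previous ones; this prepends such a segment.
    block : ∀ {q b a p c d ℓ} r → x b ⟶ x a → q + r ≡ b → b ≤ 7 + 2 * h → SPath (x a) (x p) ℓ (I c d) →
            d < q → c ≤ q → SPath (x q) (x p) (r + suc ℓ) (I c b)
    block {q} {b} {d = d} r b⟶a q+r b≤ rest d<q c≤q = weaken
      (λ { (inj₁ (at l q≤l l≤b e)) → at l (≤-trans c≤q q≤l) l≤b e
         ; (inj₂ (at l c≤l l≤d e)) → at l c≤l (≤-trans l≤d (≤-trans (<⇒≤ d<q) (m+n≤o⇒m≤o q (≤-reflexive q+r)))) e })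
      (join (base r q+r b≤) b⟶a rest
        λ { (at l q≤l l≤b refl) (at m c≤m m≤d e) → inj m l (<-≤-trans (≤-<-trans m≤d d<q) q≤l) (≤-trans l≤b b≤) (sym e) })

    back-arc : ∀ {q p ℓ M} → SPath (x q) (x p) ℓ M → ℓ ≡ 5 + 2 * h → 2 + p ≤ q → q ≤ 7 + 2 * h → x q ⟶ x p
    back-arc P refl p<q q≤ with adj P
    ... | inj₁ r = r
    ... | inj₂ r = contradiction r (short p<q q≤)

    back-k : ∀ {j} i → j ≡ i + (5 + 2 * h) → j ≤ 7 + 2 * h → x j ⟶ x i
    back-k i refl j≤ with adj (base {i} (5 + 2 * h) refl j≤)
    ... | inj₂ r = r
    ... | inj₁ r = contradiction r (short (slack (3 + 2 * h)
        (solve 2 (λ i h → con 2 :+ (i :+ (con 3 :+ con 2 :* h)) := i :+ (con 5 :+ con 2 :* h)) refl i h)) j≤)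

    -- By the path `x (k + 2) ⟶ x 2 ⋯ x k ⟶ x 0`. This arc closes P to a cycle of length k + 3.
    back-N-0 : x (7 + 2 * h) ⟶ x 0
    back-N-0 = back-arc
      (block 0 (back-k 2 refl ≤-refl) (+-identityʳ _) ≤-refl
        (block (3 + 2 * h) (back-k 0 refl (slack 2
            (solve 1 (λ h → con 5 :+ (con 2 :* h :+ con 2) := con 7 :+ con 2 :* h) refl h))) refl (slack 2
            (solve 1 (λ h → con 5 :+ (con 2 :* h :+ con 2) := con 7 :+ con 2 :* h) refl h))
          (base {0} 0 refl z≤n) (s≤s z≤n) z≤n)
        (slack 1 (solve 1 (λ h → con 6 :+ (con 2 :* h :+ con 1) := con 7 :+ con 2 :* h) refl h)) z≤n)
      (solve 1 (λ h → con 4 :+ (con 2 :* h :+ con 1) := con 5 :+ con 2 :* h) refl h) (s≤s (s≤s z≤n)) ≤-refl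

    -- Going around the cycle closed by `back-N-0` from `x (3 + i)` to `x i` leaves out three of its
    -- k + 3 arcs.
    back-3 : ∀ {j} i → j ≡ 3 + i → j ≤ 7 + 2 * h → x j ⟶ x i
    back-3 i refl j≤ with remainder j≤
    ... | r , e = back-arc
      (block r back-N-0 e ≤-refl (base {0} i refl (≤-trans (m≤n+m i 3) j≤)) (s≤s (m≤n+m i 2)) z≤n)
      (balance e
          (solve 3 (λ r i h → r :+ (con 1 :+ i) :+ (con 7 :+ con 2 :* h) := con 3 :+ (i :+ r :+ (con 5 :+ con 2 :* h))) refl r i h)) (s≤s (s≤s (n≤1+n i))) j≤

    -- Descending induction on `e` from `e = k - 1`, by the path
    -- `x (k + 2) ⟶ x (e + 2) ⋯ x k ⟶ x 0 ⋯ x e`.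
    back-from-N : ∀ {e} a → e ≡ 2 * a → e ≤ 5 + 2 * h → x (7 + 2 * h) ⟶ x e
    back-from-N a refl e≤ with remainder (s≤s⁻¹ (*-cancelˡ-< 2 a (3 + h) (≤-trans (s≤s e≤) (≤-reflexive
        (solve 1 (λ h → con 6 :+ con 2 :* h := con 2 :* (con 3 :+ h)) refl h)))))
    ... | c , a+c = go c a a+c
      where
      go : ∀ c a → a + c ≡ 2 + h → x (7 + 2 * h) ⟶ x (2 * a)
      go zero a a+c = back-arc (block 0 back-N-0 (+-identityʳ _) ≤-refl (base {0} (4 + 2 * h) e₁ (linear 3 e₂
          (solve 2 (λ a h → con 2 :* a :+ (con 4 :+ con 2 :* h) :+ con 3 := con 2 :* a :+ (con 7 :+ con 2 :* h)) refl a h)))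
                        (linear 2 e₂
                            (solve 2 (λ a h → con 1 :+ (con 2 :* a :+ (con 4 :+ con 2 :* h) :+ con 2) := con 2 :* a :+ (con 7 :+ con 2 :* h)) refl a h)) z≤n) refl (linear 1 e₂
                            (solve 2 (λ a h → con 2 :+ (con 2 :* a :+ (con 4 :+ con 2 :* h) :+ con 1) := con 2 :* a :+ (con 7 :+ con 2 :* h)) refl a h)) ≤-refl
        where
        e₁ : 4 + 2 * h ≡ 2 * a
        e₁ = balance (cong (2 *_) (sym a+c))
            (solve 2 (λ a h → con 4 :+ (con 2 :* h :+ con 2 :* (a :+ con 0)) := con 2 :* (con 2 :+ h) :+ con 2 :* a) refl a h)
        e₂ : 2 * a ≤ 4 + 2 * h
        e₂ = ≤-reflexive (sym e₁)
      go (suc c) a a+c = back-arc (block 0 (go c (suc a) (trans (sym (+-suc a c)) a+c)) (+-identityʳ _) ≤-refl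
          (block (1 + 2 * c) (back-k 0 refl (slack 2
              (solve 1 (λ h → con 5 :+ (con 2 :* h :+ con 2) := con 7 :+ con 2 :* h) refl h))) (balance e₁
              (solve 3 (λ a c h → con 2 :* (con 1 :+ a) :+ (con 1 :+ con 2 :* c) :+ con 2 :* (con 2 :+ h) := con 2 :* (a :+ (con 1 :+ c)) :+ (con 5 :+ con 2 :* h)) refl a c h)) (slack 2
              (solve 1 (λ h → con 5 :+ (con 2 :* h :+ con 2) := con 7 :+ con 2 :* h) refl h))
            (base {0} (2 * a) refl (linear (5 + 2 * c) (≤-reflexive e₁)
                (solve 3 (λ a c h → con 2 :* a :+ con 2 :* (con 2 :+ h) :+ (con 5 :+ con 2 :* c) := con 2 :* (a :+ (con 1 :+ c)) :+ (con 7 :+ con 2 :* h)) refl a c h))) (slack 1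
                (solve 1 (λ a → con 1 :+ (con 2 :* a :+ con 1) := con 2 :* (con 1 :+ a)) refl a)) z≤n)
          (slack 1 (solve 1 (λ h → con 6 :+ (con 2 :* h :+ con 1) := con 7 :+ con 2 :* h) refl h)) z≤n)
        (balance e₁
            (solve 3 (λ a c h → con 2 :+ (con 2 :* c :+ (con 1 :+ con 2 :* a) :+ con 2 :* (con 2 :+ h)) := con 2 :* (a :+ (con 1 :+ c)) :+ (con 5 :+ con 2 :* h)) refl a c h)) (linear (3 + 2 * c) (≤-reflexive e₁)
            (solve 3 (λ a c h → con 2 :+ (con 2 :* a :+ con 2 :* (con 2 :+ h) :+ (con 3 :+ con 2 :* c)) := con 2 :* (a :+ (con 1 :+ c)) :+ (con 7 :+ con 2 :* h)) refl a c h)) ≤-refl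
        where
        e₁ : 2 * (a + suc c) ≡ 2 * (2 + h)
        e₁ = cong (2 *_) a+c

    -- Ascending induction on `f`, by the path `x f ⋯ x (k + 2) ⟶ x 2 ⋯ x (f - 2) ⟶ x 0`.
    back-to-0 : ∀ {f} a → f ≡ 3 + 2 * a → f ≤ 7 + 2 * h → x f ⟶ x 0
    back-to-0 zero refl _ = back-3 0 refl (s≤s (s≤s (s≤s z≤n)))
    back-to-0 (suc a) refl f≤ with remainder f≤
    ... | r , e = back-arc
      (block r (back-from-N 1 refl (s≤s (s≤s z≤n))) e ≤-refl
        (block (1 + 2 * a) (back-to-0 a refl (linear (2 + r) (≤-reflexive e)
            (solve 3 (λ r a h → con 3 :+ (con 2 :* a :+ (con 7 :+ con 2 :* h) :+ (con 2 :+ r)) := con 4 :+ (a :+ (con 1 :+ (a :+ con 0)) :+ r :+ (con 7 :+ con 2 :* h))) refl r a h)))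
          refl (linear (2 + r) (≤-reflexive e)
              (solve 3 (λ r a h → con 3 :+ (con 2 :* a :+ (con 7 :+ con 2 :* h) :+ (con 2 :+ r)) := con 4 :+ (a :+ (con 1 :+ (a :+ con 0)) :+ r :+ (con 7 :+ con 2 :* h))) refl r a h))
          (base {0} 0 refl z≤n) (s≤s z≤n) z≤n)
        (slack 1
            (solve 1 (λ a → con 4 :+ (con 2 :* a :+ con 1) := con 4 :+ (a :+ (con 1 :+ (a :+ con 0)))) refl a)) z≤n)
      (balance e
          (solve 3 (λ r a h → r :+ (con 2 :+ (con 2 :* a :+ con 1)) :+ (con 7 :+ con 2 :* h) := con 4 :+ (a :+ (con 1 :+ (a :+ con 0)) :+ r :+ (con 5 :+ con 2 :* h))) refl r a h)) (s≤s (s≤s z≤n)) f≤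

    -- The known jumps from the top of P reach even indices and those onto `x 0` start at odd ones.
    -- So the middle block runs from the least even number above `p` to an odd number below `q`, and
    -- `c` regulates its length in steps of two.
    three-blocks : ∀ p c {q} r → 4 + 2 * c + p ≤ q → q + r ≡ 7 + 2 * h →
                   SPath (x q) (x p) (r + suc (1 + 2 * c + suc p)) (I 0 (7 + 2 * h))
    three-blocks p c {q} r p≪q e with halve p
    ... | a , o , o′ , refl , oo′ = block r (back-from-N (suc a) refl
              (linear (2 * c + o + r) (+-mono-≤ p≪q (≤-reflexive e))
                  (solve 6 (λ a o c q r h → con 2 :* (con 1 :+ a) :+ (q :+ (con 7 :+ con 2 :* h)) :+ (con 2 :* c :+ o :+ r) := con 4 :+ (con 2 :* c :+ (con 2 :* a :+ o) :+ (q :+ r) :+ (con 5 :+ con 2 :* h))) refl a o c q r h))) e ≤-refl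
        (block {2 * suc a} {3 + 2 * (a + c)} (1 + 2 * c) (back-to-0 (a + c) refl f≤)
            (solve 2 (λ a c → con 2 :* (con 1 :+ a) :+ (con 1 :+ con 2 :* c) := con 3 :+ con 2 :* (a :+ c)) refl a c) f≤
          (base {0} (2 * a + o) refl (linear (4 + 2 * c + r) (+-mono-≤ p≪q (≤-reflexive e))
              (solve 6 (λ a o c q r h → con 2 :* a :+ o :+ (q :+ (con 7 :+ con 2 :* h)) :+ (con 4 :+ (con 2 :* c :+ r)) := con 4 :+ (con 2 :* c :+ (con 2 :* a :+ o) :+ (q :+ r) :+ (con 7 :+ con 2 :* h))) refl a o c q r h)))
          (linear o′ (≤-reflexive oo′)
              (solve 3 (λ a o o′ → con 1 :+ (con 2 :* a :+ o :+ con 1 :+ o′) := o :+ o′ :+ con 2 :* (con 1 :+ a)) refl a o o′)) z≤n)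
        (linear o p≪q
            (solve 4 (λ a o c q → con 4 :+ (con 2 :* (a :+ c) :+ q :+ o) := con 4 :+ (con 2 :* c :+ (con 2 :* a :+ o) :+ q)) refl a o c q)) z≤n
      where
      f≤ : 3 + 2 * (a + c) ≤ 7 + 2 * h
      f≤ = linear (1 + o + r) (+-mono-≤ p≪q (≤-reflexive e))
          (solve 6 (λ a o c q r h → con 3 :+ (con 2 :* (a :+ c) :+ (q :+ (con 7 :+ con 2 :* h)) :+ (con 1 :+ (o :+ r))) := con 4 :+ (con 2 :* c :+ (con 2 :* a :+ o) :+ (q :+ r) :+ (con 7 :+ con 2 :* h))) refl a o c q r h)

    back : ∀ {j} i d → j ≡ 3 + 2 * d + i → j ≤ 7 + 2 * h → x j ⟶ x i
    back i zero    e    j≤ = back-3 i e j≤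
    back i (suc d) refl j≤ with remainder j≤
    ... | r , e = back-arc (three-blocks i d {3 + 2 * suc d + i} r (slack 1
        (solve 2 (λ i d → con 4 :+ (con 2 :* d :+ i :+ con 1) := con 3 :+ (con 2 :* (con 1 :+ d) :+ i)) refl i d)) e) (balance e
        (solve 4 (λ r d i h → r :+ (con 2 :+ (con 2 :* d :+ (con 1 :+ i))) :+ (con 7 :+ con 2 :* h) := con 4 :+ (d :+ (con 1 :+ (d :+ con 0)) :+ i :+ r :+ (con 5 :+ con 2 :* h))) refl r d i h))
                    (slack (3 + 2 * d)
                        (solve 2 (λ i d → con 2 :+ (i :+ (con 3 :+ con 2 :* d)) := con 3 :+ (con 2 :* (con 1 :+ d) :+ i)) refl i d)) j≤



  -- Back arcs between indices of equal parity

  BackwardComplete : Set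
  BackwardComplete = ∀ {i j} → 2 + i ≤ j → j ≤ 7 + 2 * h → x j ⟶ x i

  EvenBackArc : ℕ → ℕ → Set
  EvenBackArc i d = 2 + 2 * d + i ≤ 7 + 2 * h × x (2 + 2 * d + i) ⟶ x i

  -- In the next five lemmas the given arc is one of the jumps of a path of length k in P, which
  -- shows that a longer even back arc exists; iterating them ends at the arc x (k + 1) ⟶ x 0.
  abstract

    widen : ∀ i d → 4 + 2 * d + i ≤ 5 + 2 * h → EvenBackArc (2 + i) d → EvenBackArc i (2 + d)
    widen i d j≤ (_ , r) with halve i | remainder (≤-trans (s≤s (s≤s j≤)) (≤-reflexive {7 + 2 * h} refl))
    ... | a , o , o′ , refl , oo′ | r₁ , e = q≤ , back-arc
      -- With `i = 2 * a + o`, the path is `x q ⋯ x (k + 2) ⟶ x (4 + 2 * a) ⋯ x (4 + 2 * d + i) ⟶ x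
      -- (2 + i) ⋯ x (3 + 2 * a) ⟶ x 0 ⋯ x i`, where `q = 6 + 2 * d + i`. The remainder `o`
      -- lengthens the second block and shortens the third, so the length is k for either parity of
      -- `i`.
      (block r₁ (back-from-N (2 + a) refl (linear (2 * d + o) j≤
          (solve 4 (λ a o d h → con 2 :* (con 2 :+ a) :+ (con 5 :+ con 2 :* h) :+ (con 2 :* d :+ o) := con 4 :+ (con 2 :* d :+ (con 2 :* a :+ o) :+ (con 5 :+ con 2 :* h))) refl a o d h))) e′ ≤-refl
        (block {2 * (2 + a)} (o + 2 * d) r
            (solve 3 (λ a o d → con 2 :* (con 2 :+ a) :+ (o :+ con 2 :* d) := con 2 :+ (con 2 :* d :+ (con 2 :+ (con 2 :* a :+ o)))) refl a o d) (linear 2 j≤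
            (solve 4 (λ a o d h → con 2 :+ (con 2 :* d :+ (con 2 :+ (con 2 :* a :+ o)) :+ (con 5 :+ con 2 :* h) :+ con 2) := con 4 :+ (con 2 :* d :+ (con 2 :* a :+ o) :+ (con 7 :+ con 2 :* h))) refl a o d h))
          (block {2 + (2 * a + o)} {3 + 2 * a} o′ (back-to-0 a refl f≤) (balance oo′
              (solve 3 (λ a o o′ → con 2 :+ (con 2 :* a :+ o :+ o′ :+ con 1) := o :+ o′ :+ (con 3 :+ con 2 :* a)) refl a o o′)) f≤
            (base {0} (2 * a + o) refl (linear (4 + 2 * d + 2) j≤
                (solve 4 (λ a o d h → con 2 :* a :+ o :+ (con 5 :+ con 2 :* h) :+ (con 4 :+ (con 2 :* d :+ con 2)) := con 4 :+ (con 2 :* d :+ (con 2 :* a :+ o) :+ (con 7 :+ con 2 :* h))) refl a o d h)))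
            (slack 1
                (solve 2 (λ a o → con 1 :+ (con 2 :* a :+ o :+ con 1) := con 2 :+ (con 2 :* a :+ o)) refl a o)) z≤n)
          (slack 0 (solve 1 (λ a → con 4 :+ (con 2 :* a :+ con 0) := con 2 :* (con 2 :+ a)) refl a)) z≤n)
        (slack 1
            (solve 3 (λ a o d → con 3 :+ (con 2 :* d :+ (con 2 :+ (con 2 :* a :+ o)) :+ con 1) := con 4 :+ (d :+ con 1 :* (con 2 :+ d) :+ (con 2 :* a :+ o))) refl a o d)) z≤n)
      (balance (cong₂ _+_ oo′ e)
          (solve 6 (λ r₁ o o′ a d h → r₁ :+ (con 1 :+ (o :+ con 2 :* d :+ (con 1 :+ (o′ :+ (con 1 :+ (con 2 :* a :+ o)))))) :+ (con 8 :+ con 2 :* h) := o :+ o′ :+ (con 6 :+ (con 2 :* d :+ (con 2 :* a :+ o) :+ r₁)) :+ (con 5 :+ con 2 :* h)) refl r₁ o o′ a d h)) (slack (4 + 2 * d)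
          (solve 3 (λ a o d → con 2 :+ (con 2 :* a :+ o :+ (con 4 :+ con 2 :* d)) := con 4 :+ (d :+ con 1 :* (con 2 :+ d) :+ (con 2 :* a :+ o))) refl a o d)) q≤
      where
      q≤ : 2 + 2 * (2 + d) + (2 * a + o) ≤ 7 + 2 * h
      q≤ = linear 0 j≤
          (solve 4 (λ a o d h → con 2 :+ (con 2 :* (con 2 :+ d) :+ (con 2 :* a :+ o) :+ (con 5 :+ con 2 :* h) :+ con 0) := con 4 :+ (con 2 :* d :+ (con 2 :* a :+ o) :+ (con 7 :+ con 2 :* h))) refl a o d h)
      e′ : 2 + 2 * (2 + d) + (2 * a + o) + r₁ ≡ 7 + 2 * h
      e′ = balance e
          (solve 5 (λ a o d r₁ h → con 2 :+ (con 2 :* (con 2 :+ d) :+ (con 2 :* a :+ o) :+ r₁ :+ (con 7 :+ con 2 :* h)) := con 6 :+ (con 2 :* d :+ (con 2 :* a :+ o) :+ r₁ :+ (con 7 :+ con 2 :* h))) refl a o d r₁ h)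
      f≤ : 3 + 2 * a ≤ 7 + 2 * h
      f≤ = linear (3 + 2 * d + o) j≤
          (solve 4 (λ a o d h → con 3 :+ (con 2 :* a :+ (con 5 :+ con 2 :* h) :+ (con 3 :+ (con 2 :* d :+ o))) := con 4 :+ (con 2 :* d :+ (con 2 :* a :+ o) :+ (con 7 :+ con 2 :* h))) refl a o d h)

    lengthen-0 : ∀ d → 4 + 2 * d ≤ 6 + 2 * h → EvenBackArc 0 d → EvenBackArc 0 (1 + d)
    lengthen-0 d j≤ (_ , r) with remainder j≤
    ... | r₁ , e = q≤ , back-arc
      (block {2 + 2 * (1 + d) + 0} r₁ (back {6 + 2 * h} 1 (1 + h)
          (solve 1 (λ h → con 6 :+ con 2 :* h := con 3 :+ (con 2 :* (con 1 :+ h) :+ con 1)) refl h) (n≤1+n _)) (balance e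
          (solve 3 (λ d r₁ h → con 2 :+ (con 2 :* (con 1 :+ d) :+ con 0 :+ r₁ :+ (con 6 :+ con 2 :* h)) := con 4 :+ (con 2 :* d :+ r₁ :+ (con 6 :+ con 2 :* h))) refl d r₁ h)) (n≤1+n _)
        (block {1} (1 + 2 * d) r
            (solve 1 (λ d → con 2 :+ con 2 :* d := con 2 :+ (con 2 :* d :+ con 0)) refl d) (linear 3 j≤
            (solve 2 (λ d h → con 2 :+ (con 2 :* d :+ con 0 :+ (con 6 :+ con 2 :* h) :+ con 3) := con 4 :+ (con 2 :* d :+ (con 7 :+ con 2 :* h))) refl d h))
          (base {0} 0 refl z≤n) (s≤s z≤n) z≤n)
        (slack 1
            (solve 1 (λ d → con 3 :+ (con 2 :* d :+ con 0 :+ con 1) := con 2 :+ (con 2 :* (con 1 :+ d) :+ con 0)) refl d)) z≤n)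
      (balance e
          (solve 3 (λ r₁ d h → r₁ :+ (con 2 :+ (con 2 :* d :+ con 1)) :+ (con 6 :+ con 2 :* h) := con 4 :+ (con 2 :* d :+ r₁ :+ (con 5 :+ con 2 :* h))) refl r₁ d h)) (s≤s (s≤s z≤n)) q≤
      where
      q≤ : 2 + 2 * (1 + d) + 0 ≤ 7 + 2 * h
      q≤ = linear 1 j≤
          (solve 2 (λ d h → con 2 :+ (con 2 :* (con 1 :+ d) :+ con 0 :+ (con 6 :+ con 2 :* h) :+ con 1) := con 4 :+ (con 2 :* d :+ (con 7 :+ con 2 :* h))) refl d h)

    lengthen-1 : ∀ d → 5 + 2 * d ≤ 7 + 2 * h → EvenBackArc 1 d → EvenBackArc 1 (1 + d)
    lengthen-1 d j≤ (_ , r) with remainder j≤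
    ... | r₁ , e = q≤ , back-arc
      (block {2 + 2 * (1 + d) + 1} r₁ (back-from-N 1 refl (s≤s (s≤s z≤n))) (balance e
          (solve 3 (λ d r₁ h → con 2 :+ (con 2 :* (con 1 :+ d) :+ con 1 :+ r₁ :+ (con 7 :+ con 2 :* h)) := con 5 :+ (con 2 :* d :+ r₁ :+ (con 7 :+ con 2 :* h))) refl d r₁ h)) ≤-refl
        (block {2} (1 + 2 * d) r
            (solve 1 (λ d → con 3 :+ con 2 :* d := con 2 :+ (con 2 :* d :+ con 1)) refl d) (linear 2 j≤
            (solve 2 (λ d h → con 2 :+ (con 2 :* d :+ con 1 :+ (con 7 :+ con 2 :* h) :+ con 2) := con 5 :+ (con 2 :* d :+ (con 7 :+ con 2 :* h))) refl d h))
          (base {1} 0 refl (s≤s z≤n)) (s≤s (s≤s z≤n)) (s≤s z≤n))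
        (slack 1
            (solve 1 (λ d → con 3 :+ (con 2 :* d :+ con 1 :+ con 1) := con 2 :+ (con 2 :* (con 1 :+ d) :+ con 1)) refl d)) (s≤s z≤n))
      (balance e
          (solve 3 (λ r₁ d h → r₁ :+ (con 2 :+ (con 2 :* d :+ con 1)) :+ (con 7 :+ con 2 :* h) := con 5 :+ (con 2 :* d :+ r₁ :+ (con 5 :+ con 2 :* h))) refl r₁ d h)) (slack (2 + 2 * d)
          (solve 1 (λ d → con 5 :+ con 2 :* d := con 2 :+ (con 2 :* (con 1 :+ d) :+ con 1)) refl d)) q≤
      where
      q≤ : 2 + 2 * (1 + d) + 1 ≤ 7 + 2 * h
      q≤ = linear 0 j≤
          (solve 2 (λ d h → con 2 :+ (con 2 :* (con 1 :+ d) :+ con 1 :+ (con 7 :+ con 2 :* h) :+ con 0) := con 5 :+ (con 2 :* d :+ (con 7 :+ con 2 :* h))) refl d h)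

    widen-N-1 : ∀ i d → 4 + 2 * d + i ≡ 6 + 2 * h → EvenBackArc (2 + i) d → EvenBackArc i (1 + d)
    widen-N-1 i d e (_ , r) = q≤ , back-arc
      (block {2 + 2 * (1 + d) + i} 0 (subst (λ j → x j ⟶ x (2 + i)) j≡ r) (+-identityʳ _) q≤
        (block {2 + i} {5 + 2 * h} (1 + 2 * d) (back-k 0 refl (slack 2
            (solve 1 (λ h → con 5 :+ (con 2 :* h :+ con 2) := con 7 :+ con 2 :* h) refl h))) (balance e
            (solve 3 (λ i d h → con 2 :+ (i :+ (con 1 :+ con 2 :* d) :+ (con 6 :+ con 2 :* h)) := con 4 :+ (con 2 :* d :+ i :+ (con 5 :+ con 2 :* h))) refl i d h)) (slack 2
            (solve 1 (λ h → con 5 :+ (con 2 :* h :+ con 2) := con 7 :+ con 2 :* h) refl h))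
          (base {0} i refl (linear (5 + 2 * d) (≤-reflexive e)
              (solve 3 (λ i d h → i :+ (con 6 :+ con 2 :* h) :+ (con 5 :+ con 2 :* d) := con 4 :+ (con 2 :* d :+ i :+ (con 7 :+ con 2 :* h))) refl i d h))) (slack 1
              (solve 1 (λ i → con 1 :+ (i :+ con 1) := con 2 :+ i) refl i)) z≤n)
        (linear 0 (≤-reflexive (sym e))
            (solve 3 (λ i d h → con 6 :+ (con 2 :* h :+ (con 4 :+ (con 2 :* d :+ i)) :+ con 0) := con 6 :+ (con 2 :* h :+ (con 2 :+ (con 2 :* (con 1 :+ d) :+ i)))) refl i d h)) z≤n)
      (balance e
          (solve 3 (λ i d h → con 2 :+ (con 2 :* d :+ (con 1 :+ i) :+ (con 6 :+ con 2 :* h)) := con 4 :+ (con 2 :* d :+ i :+ (con 5 :+ con 2 :* h))) refl i d h)) (slack (2 + 2 * d)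
          (solve 2 (λ i d → con 2 :+ (i :+ (con 2 :+ con 2 :* d)) := con 2 :+ (con 2 :* (con 1 :+ d) :+ i)) refl i d)) q≤
      where
      j≡ : 2 + 2 * d + (2 + i) ≡ 2 + 2 * (1 + d) + i
      j≡ = solve 2 (λ i d → con 2 :+ (con 2 :* d :+ (con 2 :+ i)) := con 2 :+ (con 2 :* (con 1 :+ d) :+ i)) refl i d
      q≤ : 2 + 2 * (1 + d) + i ≤ 7 + 2 * h
      q≤ = linear 1 (≤-reflexive e)
          (solve 3 (λ i d h → con 2 :+ (con 2 :* (con 1 :+ d) :+ i :+ (con 6 :+ con 2 :* h) :+ con 1) := con 4 :+ (con 2 :* d :+ i :+ (con 7 :+ con 2 :* h))) refl i d h)

    widen-N : ∀ i d → 5 + 2 * d + i ≡ 7 + 2 * h → EvenBackArc (3 + i) d → EvenBackArc (1 + i) (1 + d)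
    widen-N i d e (_ , r) = q≤ , back-arc
      (block {2 + 2 * (1 + d) + (1 + i)} 0 (subst (λ j → x j ⟶ x (3 + i)) j≡ r) (+-identityʳ _) q≤
        (block {3 + i} {6 + 2 * h} (1 + 2 * d) (back {6 + 2 * h} 1 (1 + h)
            (solve 1 (λ h → con 6 :+ con 2 :* h := con 3 :+ (con 2 :* (con 1 :+ h) :+ con 1)) refl h) (n≤1+n _)) (balance e
            (solve 3 (λ i d h → con 3 :+ (i :+ (con 1 :+ con 2 :* d) :+ (con 7 :+ con 2 :* h)) := con 5 :+ (con 2 :* d :+ i :+ (con 6 :+ con 2 :* h))) refl i d h)) (n≤1+n _)
          (base {1} i refl (linear (4 + 2 * d) (≤-reflexive e)
              (solve 3 (λ i d h → con 1 :+ (i :+ (con 7 :+ con 2 :* h) :+ (con 4 :+ con 2 :* d)) := con 5 :+ (con 2 :* d :+ i :+ (con 7 :+ con 2 :* h))) refl i d h))) (slack 1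
              (solve 1 (λ i → con 2 :+ (i :+ con 1) := con 3 :+ i) refl i)) (s≤s z≤n))
        (linear 0 (≤-reflexive (sym e))
            (solve 3 (λ i d h → con 7 :+ (con 2 :* h :+ (con 5 :+ (con 2 :* d :+ i)) :+ con 0) := con 7 :+ (con 2 :* h :+ (con 2 :+ (con 2 :* (con 1 :+ d) :+ (con 1 :+ i))))) refl i d h)) (s≤s z≤n))
      (balance e
          (solve 3 (λ i d h → con 2 :+ (con 2 :* d :+ (con 1 :+ i) :+ (con 7 :+ con 2 :* h)) := con 5 :+ (con 2 :* d :+ i :+ (con 5 :+ con 2 :* h))) refl i d h)) (slack (2 + 2 * d)
          (solve 2 (λ i d → con 3 :+ (i :+ (con 2 :+ con 2 :* d)) := con 2 :+ (con 2 :* (con 1 :+ d) :+ (con 1 :+ i))) refl i d)) q≤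
      where
      j≡ : 2 + 2 * d + (3 + i) ≡ 2 + 2 * (1 + d) + (1 + i)
      j≡ = solve 2 (λ i d → con 2 :+ (con 2 :* d :+ (con 3 :+ i)) := con 2 :+ (con 2 :* (con 1 :+ d) :+ (con 1 :+ i))) refl i d
      q≤ : 2 + 2 * (1 + d) + (1 + i) ≤ 7 + 2 * h
      q≤ = linear 0 (≤-reflexive e)
          (solve 3 (λ i d h → con 2 :+ (con 2 :* (con 1 :+ d) :+ (con 1 :+ i) :+ (con 7 :+ con 2 :* h) :+ con 0) := con 5 :+ (con 2 :* d :+ i :+ (con 7 :+ con 2 :* h))) refl i d h)

    climb-0 : ∀ g d → 2 + 2 * d + 2 * g ≡ 6 + 2 * h → EvenBackArc 0 d → x (6 + 2 * h) ⟶ x 0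
    climb-0 zero    d e (_ , r) = subst (λ j → x j ⟶ x 0) (balance {2 + 2 * d + 0} {6 + 2 * h} e
        (solve 2 (λ d h → con 2 :+ (con 2 :* d :+ con 0 :+ (con 6 :+ con 2 :* h)) := con 2 :+ (con 2 :* d :+ con 2 :* con 0 :+ (con 6 :+ con 2 :* h))) refl d h)) r
    climb-0 (suc g) d e s = climb-0 g (1 + d) (balance e
        (solve 3 (λ d g h → con 2 :+ (con 2 :* (con 1 :+ d) :+ con 2 :* g :+ (con 6 :+ con 2 :* h)) := con 2 :+ (con 2 :* d :+ con 2 :* (con 1 :+ g) :+ (con 6 :+ con 2 :* h))) refl d g h))
      (lengthen-0 d (linear (2 * g) (≤-reflexive e)
          (solve 3 (λ d g h → con 4 :+ (con 2 :* d :+ (con 6 :+ con 2 :* h) :+ con 2 :* g) := con 2 :+ (con 2 :* d :+ con 2 :* (con 1 :+ g) :+ (con 6 :+ con 2 :* h))) refl d g h)) s)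

    -- The widening at `x 1` ends with `x (k + 2) ⟶ x 1`, which is turned into the required arc by
    -- the path `x (k + 1) ⟶ x (k + 2) ⟶ x 1 ⋯ x (k - 2) ⟶ x 0`.
    climb-1 : ∀ g d → 3 + 2 * d + 2 * g ≡ 7 + 2 * h → EvenBackArc 1 d → x (6 + 2 * h) ⟶ x 0
    climb-1 zero    d e (_ , r) = back-arc
      (block {6 + 2 * h} {7 + 2 * h} 1 (subst (λ j → x j ⟶ x 1) (balance {2 + 2 * d + 1} {7 + 2 * h} e
          (solve 2 (λ d h → con 2 :+ (con 2 :* d :+ con 1 :+ (con 7 :+ con 2 :* h)) := con 3 :+ (con 2 :* d :+ con 2 :* con 0 :+ (con 7 :+ con 2 :* h))) refl d h)) r) (+-comm _ 1) ≤-refl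
        (block {1} {3 + 2 * h} (2 + 2 * h) (back-to-0 h refl (slack 4
            (solve 1 (λ h → con 3 :+ (con 2 :* h :+ con 4) := con 7 :+ con 2 :* h) refl h))) refl (slack 4
            (solve 1 (λ h → con 3 :+ (con 2 :* h :+ con 4) := con 7 :+ con 2 :* h) refl h))
          (base {0} 0 refl z≤n) (s≤s z≤n) z≤n)
        (slack 2 (solve 1 (λ h → con 4 :+ (con 2 :* h :+ con 2) := con 6 :+ con 2 :* h) refl h)) z≤n)
      (solve 1 (λ h → con 4 :+ (con 2 :* h :+ con 1) := con 5 :+ con 2 :* h) refl h) (s≤s (s≤s z≤n)) (n≤1+n _)
    climb-1 (suc g) d e s = climb-1 g (1 + d) (balance e
        (solve 3 (λ d g h → con 3 :+ (con 2 :* (con 1 :+ d) :+ con 2 :* g :+ (con 7 :+ con 2 :* h)) := con 3 :+ (con 2 :* d :+ con 2 :* (con 1 :+ g) :+ (con 7 :+ con 2 :* h))) refl d g h))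
      (lengthen-1 d (linear (2 * g) (≤-reflexive e)
          (solve 3 (λ d g h → con 5 :+ (con 2 :* d :+ (con 7 :+ con 2 :* h) :+ con 2 :* g) := con 3 :+ (con 2 :* d :+ con 2 :* (con 1 :+ g) :+ (con 7 :+ con 2 :* h))) refl d g h)) s)

    even-gap : ∀ {a b} → 2 * a ≤ 1 + 2 * b → ∃ λ g → a + g ≡ b
    even-gap {a} {b} le = remainder (s≤s⁻¹ (*-cancelˡ-< 2 a (suc b) (≤-trans (s≤s le) (≤-reflexive
        (solve 1 (λ b → con 2 :+ con 2 :* b := con 2 :* (con 1 :+ b)) refl b)))))

    -- The lower end descends by two until it is 0 or 1. Meanwhile the upper end rises by two if
    -- there is room for it and stays fixed otherwise; after that only the upper end moves.
    longest-even : ∀ i d → EvenBackArc i d → x (6 + 2 * h) ⟶ x 0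
    longest-even zero d s with even-gap {1 + d} {3 + h} (linear 0 (proj₁ s)
        (solve 2 (λ d h → con 2 :* (con 1 :+ d) :+ (con 7 :+ con 2 :* h) :+ con 0 := con 2 :+ (con 2 :* d :+ con 0 :+ (con 1 :+ con 2 :* (con 3 :+ h)))) refl d h))
    ... | g , e = climb-0 g d (balance (cong (2 *_) e)
        (solve 3 (λ d g h → con 2 :+ (con 2 :* d :+ con 2 :* g :+ con 2 :* (con 3 :+ h)) := con 2 :* (con 1 :+ (d :+ g)) :+ (con 6 :+ con 2 :* h)) refl d g h)) s
    longest-even (suc zero) d s with even-gap {1 + d} {3 + h} (linear 1 (proj₁ s)
        (solve 2 (λ d h → con 2 :* (con 1 :+ d) :+ (con 7 :+ con 2 :* h) :+ con 1 := con 2 :+ (con 2 :* d :+ con 1 :+ (con 1 :+ con 2 :* (con 3 :+ h)))) refl d h))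
    ... | g , e = climb-1 g d (balance (cong (2 *_) e)
        (solve 3 (λ d g h → con 3 :+ (con 2 :* d :+ con 2 :* g :+ con 2 :* (con 3 :+ h)) := con 2 :* (con 1 :+ (d :+ g)) :+ (con 7 :+ con 2 :* h)) refl d g h)) s
    longest-even (suc (suc i)) d s with remainder (proj₁ s)
    ... | suc (suc r) , e = longest-even i (2 + d) (widen i d (linear r (≤-reflexive e)
        (solve 4 (λ r i d h → con 4 :+ (con 2 :* d :+ i :+ (con 7 :+ con 2 :* h) :+ r) := con 2 :+ (con 2 :* d :+ (con 2 :+ i) :+ (con 2 :+ r) :+ (con 5 :+ con 2 :* h))) refl r i d h)) s)
    ... | 1 , e = longest-even i (1 + d) (widen-N-1 i d (balance e
        (solve 3 (λ i d h → con 4 :+ (con 2 :* d :+ i :+ (con 7 :+ con 2 :* h)) := con 2 :+ (con 2 :* d :+ (con 2 :+ i) :+ con 1 :+ (con 6 :+ con 2 :* h))) refl i d h)) s)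
    longest-even (suc (suc (suc i))) d s | 0 , e = longest-even (suc i) (1 + d) (widen-N i d (balance e
        (solve 3 (λ i d h → con 5 :+ (con 2 :* d :+ i :+ (con 7 :+ con 2 :* h)) := con 2 :+ (con 2 :* d :+ (con 3 :+ i) :+ con 0 :+ (con 7 :+ con 2 :* h))) refl i d h)) s)
    -- The ends would be 2 and k + 2, whose difference k is odd.
    longest-even (suc (suc zero)) d s | 0 , e with even-gap {4 + h} {2 + d} (linear 0 (≤-reflexive (sym e))
        (solve 2 (λ d h → con 2 :* (con 4 :+ h) :+ (con 2 :+ (con 2 :* d :+ con 2 :+ con 0)) :+ con 0 := con 7 :+ (con 2 :* h :+ (con 1 :+ con 2 :* (con 2 :+ d)))) refl d h))
    ... | g , e′ = contradiction {A = 1 ≤ 0} (linear (2 * g) (+-mono-≤ (≤-reflexive e) (≤-reflexive (cong (2 *_) e′)))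
        (solve 3 (λ g d h → con 8 :+ (con 2 :* h :+ con 2 :* (con 2 :+ d) :+ con 2 :* g) := con 2 :+ (con 2 :* d :+ con 2 :+ con 0 :+ con 2 :* (con 4 :+ (h :+ g)) :+ con 0)) refl g d h)) λ ()

    -- The arc `top` closes `x 0, ..., x (k + 1)` to a cycle of odd length, so that paths of length
    -- k now also join indices of equal parity. The arcs of odd gap are known from `back`.
    complete : ∀ i d → EvenBackArc i d → BackwardComplete
    complete i₀ d₀ s {i₁} {j₁} = all i₁ j₁
      where
      top : x (6 + 2 * h) ⟶ x 0
      top = longest-even i₀ d₀ s

      two-back : ∀ p → 2 + p ≤ 6 + 2 * h → x (2 + p) ⟶ x p
      two-back p p≤ with remainder p≤
      ... | r , e = back-arc (block r top e (n≤1+n _) (base {0} p refl (linear 3 p≤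
          (solve 2 (λ p h → p :+ (con 6 :+ con 2 :* h) :+ con 3 := con 2 :+ (p :+ (con 7 :+ con 2 :* h))) refl p h))) (slack 1
          (solve 1 (λ p → con 1 :+ (p :+ con 1) := con 2 :+ p) refl p)) z≤n)
                      (balance e
                          (solve 3 (λ r p h → r :+ (con 1 :+ p) :+ (con 6 :+ con 2 :* h) := con 2 :+ (p :+ r :+ (con 5 :+ con 2 :* h))) refl r p h)) ≤-refl (m≤n⇒m≤1+n p≤)

      even-to-0 : ∀ d → 2 + 2 * d ≤ 7 + 2 * h → x (2 + 2 * d) ⟶ x 0
      even-to-0 zero    _  = two-back 0 (s≤s (s≤s z≤n))
      even-to-0 (suc d) d≤ with even-gap {2 + d} {3 + h} (linear 0 d≤
          (solve 2 (λ d h → con 2 :* (con 2 :+ d) :+ (con 7 :+ con 2 :* h) :+ con 0 := con 2 :+ (con 2 :* (con 1 :+ d) :+ (con 1 :+ con 2 :* (con 3 :+ h)))) refl d h))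
      ... | g , e = subst (λ j → x j ⟶ x 0) (+-identityʳ (2 + 2 * suc d)) (proj₂ (lengthen-0 d (linear (2 * g) (≤-reflexive (cong (2 *_) e))
          (solve 3 (λ d g h → con 4 :+ (con 2 :* d :+ con 2 :* (con 3 :+ h) :+ con 2 :* g) := con 2 :* (con 2 :+ (d :+ g)) :+ (con 6 :+ con 2 :* h)) refl d g h))
                      (subst (_≤ 7 + 2 * h) (sym (+-identityʳ (2 + 2 * d))) d≤′ , subst (λ j → x j ⟶ x 0) (sym (+-identityʳ (2 + 2 * d))) (even-to-0 d d≤′))))
        where
        d≤′ : 2 + 2 * d ≤ 7 + 2 * h
        d≤′ = linear 2 d≤
            (solve 2 (λ d h → con 2 :+ (con 2 :* d :+ (con 7 :+ con 2 :* h) :+ con 2) := con 2 :+ (con 2 :* (con 1 :+ d) :+ (con 7 :+ con 2 :* h))) refl d h)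

      far-back : ∀ p d → 4 + 2 * d + p ≤ 7 + 2 * h → x (4 + 2 * d + p) ⟶ x p
      far-back p d q≤ with halve p | remainder q≤
      ... | a , o , o′ , refl , oo′ | r , e = back-arc
        (block r (back-from-N (1 + a) refl (linear (2 * d + o) q≤
            (solve 4 (λ a o d h → con 2 :* (con 1 :+ a) :+ (con 7 :+ con 2 :* h) :+ (con 2 :* d :+ o) := con 4 :+ (con 2 :* d :+ (con 2 :* a :+ o) :+ (con 5 :+ con 2 :* h))) refl a o d h))) e ≤-refl
          (block {2 * (1 + a)} {2 + 2 * (a + d)} (2 * d) (even-to-0 (a + d) f≤)
              (solve 2 (λ a d → con 2 :* (con 1 :+ a) :+ con 2 :* d := con 2 :+ con 2 :* (a :+ d)) refl a d) f≤
            (base {0} (2 * a + o) refl (linear (4 + 2 * d) q≤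
                (solve 4 (λ a o d h → con 2 :* a :+ o :+ (con 7 :+ con 2 :* h) :+ (con 4 :+ con 2 :* d) := con 4 :+ (con 2 :* d :+ (con 2 :* a :+ o) :+ (con 7 :+ con 2 :* h))) refl a o d h)))
            (linear o′ (≤-reflexive oo′)
                (solve 3 (λ a o o′ → con 1 :+ (con 2 :* a :+ o :+ con 1 :+ o′) := o :+ o′ :+ con 2 :* (con 1 :+ a)) refl a o o′)) z≤n)
          (slack (1 + o)
              (solve 3 (λ a o d → con 3 :+ (con 2 :* (a :+ d) :+ (con 1 :+ o)) := con 4 :+ (con 2 :* d :+ (con 2 :* a :+ o))) refl a o d)) z≤n)
        (balance e
            (solve 5 (λ r a o d h → r :+ (con 1 :+ (con 2 :* d :+ (con 1 :+ (con 2 :* a :+ o)))) :+ (con 7 :+ con 2 :* h) := con 4 :+ (con 2 :* d :+ (con 2 :* a :+ o) :+ r :+ (con 5 :+ con 2 :* h))) refl r a o d h)) (slack (2 + 2 * d)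
            (solve 3 (λ a o d → con 2 :+ (con 2 :* a :+ o :+ (con 2 :+ con 2 :* d)) := con 4 :+ (con 2 :* d :+ (con 2 :* a :+ o))) refl a o d)) q≤
        where
        f≤ : 2 + 2 * (a + d) ≤ 7 + 2 * h
        f≤ = linear (2 + o) q≤
            (solve 4 (λ a o d h → con 2 :+ (con 2 :* (a :+ d) :+ (con 7 :+ con 2 :* h) :+ (con 2 :+ o)) := con 4 :+ (con 2 :* d :+ (con 2 :* a :+ o) :+ (con 7 :+ con 2 :* h))) refl a o d h)

      -- `two-back` ends its first block at `x (k + 1)`, where `top` starts, and so misses this one
      -- pair.
      last-two : x (7 + 2 * h) ⟶ x (5 + 2 * h)
      last-two = back-arc
        (block 0 (subst (λ j → x j ⟶ x 1) ((4 + 2 * (1 + h) + 1 ≡ 7 + 2 * h) ∋ solve 1 (λ h → con 4 :+ (con 2 :* (con 1 :+ h) :+ con 1) := con 7 :+ con 2 :* h) refl h) (far-back 1 (1 + h) (≤-reflexive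
            (solve 1 (λ h → con 4 :+ (con 2 :* (con 1 :+ h) :+ con 1) := con 7 :+ con 2 :* h) refl h)))) (+-identityʳ _) ≤-refl
          (base {1} (4 + 2 * h) refl (slack 2
              (solve 1 (λ h → con 5 :+ (con 2 :* h :+ con 2) := con 7 :+ con 2 :* h) refl h))) (slack 1
              (solve 1 (λ h → con 6 :+ (con 2 :* h :+ con 1) := con 7 :+ con 2 :* h) refl h)) (s≤s z≤n))
        refl ≤-refl ≤-refl

      all : ∀ i j → 2 + i ≤ j → j ≤ 7 + 2 * h → x j ⟶ x i
      all i j i≪j j≤ with remainder i≪j
      ... | t , refl with halve t
      ...   | a , 1 , _ , refl , _ = back {2 + i + (2 * a + 1)} i a
          (solve 2 (λ i a → con 2 :+ (i :+ (con 2 :* a :+ con 1)) := con 3 :+ (con 2 :* a :+ i)) refl i a) j≤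
      ...   | suc a , 0 , _ , refl , _ = subst (λ j → x j ⟶ x i) e (far-back i a (≤-trans (≤-reflexive e) j≤))
        where
        e : 4 + 2 * a + i ≡ 2 + i + (2 * suc a + 0)
        e = solve 2 (λ a i → con 4 :+ (con 2 :* a :+ i) := con 2 :+ (i :+ (con 2 :* (con 1 :+ a) :+ con 0))) refl a i
      ...   | zero , 0 , _ , refl , _ with m≤n⇒m<n∨m≡n j≤
      ...     | inj₁ (s≤s j<) = subst (λ j → x j ⟶ x i) (sym (+-identityʳ (2 + i))) (two-back i (subst (_≤ 6 + 2 * h) (+-identityʳ (2 + i)) j<))
      ...     | inj₂ j≡ = subst₂ (λ j i → x j ⟶ x i) (sym j≡) (sym (balance {i} {5 + 2 * h} j≡
          (solve 2 (λ i h → i :+ (con 7 :+ con 2 :* h) := con 2 :+ (i :+ con 0 :+ (con 5 :+ con 2 :* h))) refl i h))) last-two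
      all i j i≪j j≤ | t , refl | a , suc (suc o) , o′ , refl , ()

  -- Arcs between P and a vertex outside P

  OnP : Pred V 0ℓ
  OnP = I 0 (7 + 2 * h)

  Outside : V → Set
  Outside y = ∀ l → l ≤ 7 + 2 * h → x l ≢ y

  Adj : V → V → Set
  Adj a b = a ⟶ b ⊎ b ⟶ a

  abstract

    onP : ∀ {a b c d ℓ} → SPath a b ℓ (I c d) → d ≤ 7 + 2 * h → SPath a b ℓ OnP
    onP p d≤ = weaken (λ { (at l _ l≤d e) → at l z≤n (≤-trans l≤d d≤) e }) p

    sized : ∀ {a b ℓ ℓ′ M} → SPath a b ℓ M → ℓ ≡ ℓ′ → SPath a b ℓ′ M
    sized p e = resize e p

    outside-OnP : ∀ {y v} → Outside y → OnP v → v ≢ y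
    outside-OnP out (at l _ l≤ refl) = out l l≤

    -- Paths of length k - 1 are what `adj-in` and `adj-out` need in order to carry an adjacency
    -- from one index to another; k - 1 is even, so these stay within one parity. The jump has gap
    -- k, from `x k` if `2 + p` is at most k and from `x (k + 2)` otherwise.
    down-2 : ∀ p → 2 + p ≤ 7 + 2 * h → SPath (x (2 + p)) (x p) (4 + 2 * h) OnP
    down-2 p q≤ with 2 + p ≤? 5 + 2 * h | remainder q≤
    ... | yes q≤′ | _ with remainder q≤′
    ...   | r , e = sized (onP (block r (back-k 0 refl (slack 2
        (solve 1 (λ h → con 5 :+ (con 2 :* h :+ con 2) := con 7 :+ con 2 :* h) refl h))) e (slack 2
        (solve 1 (λ h → con 5 :+ (con 2 :* h :+ con 2) := con 7 :+ con 2 :* h) refl h))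
                        (base {0} p refl (linear 2 q≤
                            (solve 2 (λ p h → p :+ (con 7 :+ con 2 :* h) :+ con 2 := con 2 :+ (p :+ (con 7 :+ con 2 :* h))) refl p h))) (slack 1
                            (solve 1 (λ p → con 1 :+ (p :+ con 1) := con 2 :+ p) refl p)) z≤n) (slack 2
                            (solve 1 (λ h → con 5 :+ (con 2 :* h :+ con 2) := con 7 :+ con 2 :* h) refl h)))
                        (balance e
                            (solve 3 (λ r p h → r :+ (con 1 :+ p) :+ (con 5 :+ con 2 :* h) := con 2 :+ (p :+ r :+ (con 4 :+ con 2 :* h))) refl r p h))
    down-2 p q≤ | no q≰ | r , e with remainder {2} (≤-trans {j = 4 + 2 * h} (slack (2 + 2 * h) refl) (s≤s⁻¹ (s≤s⁻¹ (≰⇒> q≰))))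
    ... | s , refl = sized (onP (block {2 + (2 + s)} r (back-k 2 refl ≤-refl) e ≤-refl
                         (base {2} s refl (linear 2 q≤
                             (solve 2 (λ s h → con 2 :+ (s :+ (con 7 :+ con 2 :* h) :+ con 2) := con 4 :+ (s :+ (con 7 :+ con 2 :* h))) refl s h))) (slack 1
                             (solve 1 (λ s → con 3 :+ (s :+ con 1) := con 4 :+ s) refl s)) (s≤s (s≤s z≤n))) ≤-refl)
                       (balance e
                           (solve 3 (λ r s h → r :+ (con 1 :+ s) :+ (con 7 :+ con 2 :* h) := con 4 :+ (s :+ r :+ (con 4 :+ con 2 :* h))) refl r s h))

    down-4+ : ∀ c p {q} → q ≡ 4 + 2 * c + p → q ≤ 7 + 2 * h → SPath (x q) (x p) (4 + 2 * h) OnP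
    down-4+ zero p refl q≤ with remainder q≤
    ... | r , e = sized (onP (block {4 + p} r back-N-0 e ≤-refl (base {0} p refl (linear 4 q≤
        (solve 2 (λ p h → p :+ (con 7 :+ con 2 :* h) :+ con 4 := con 4 :+ (con 2 :* con 0 :+ p :+ (con 7 :+ con 2 :* h))) refl p h))) (slack 3
        (solve 1 (λ p → con 1 :+ (p :+ con 3) := con 4 :+ p) refl p)) z≤n) ≤-refl)
                    (balance e
                        (solve 3 (λ r p h → r :+ (con 1 :+ p) :+ (con 7 :+ con 2 :* h) := con 4 :+ (p :+ r :+ (con 4 :+ con 2 :* h))) refl r p h))
    down-4+ (suc c) p refl q≤ with remainder q≤
    ... | r , e = sized (three-blocks p c {4 + 2 * suc c + p} r (slack 2
        (solve 2 (λ c p → con 4 :+ (con 2 :* c :+ p :+ con 2) := con 4 :+ (con 2 :* (con 1 :+ c) :+ p)) refl c p)) e)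
                    (balance e
                        (solve 4 (λ r c p h → r :+ (con 2 :+ (con 2 :* c :+ (con 1 :+ p))) :+ (con 7 :+ con 2 :* h) := con 5 :+ (c :+ (con 1 :+ (c :+ con 0)) :+ p :+ r :+ (con 4 :+ con 2 :* h))) refl r c p h))

    up : ∀ i r {j} → j ≡ i + r → j ≤ 7 + 2 * h → SPath (x i) (x j) r OnP
    up i r refl j≤ = onP (base {i} r refl j≤) j≤

    adj-in : ∀ {y i q} → Outside y → SPath (x q) (x i) (4 + 2 * h) OnP → x i ⟶ y → Adj (x q) y
    adj-in {y} out p r = adj (resize (+-comm _ 1) (join p r (point y) λ { v∈ refl → outside-OnP out v∈ refl }))

    adj-out : ∀ {y i q} → Outside y → SPath (x i) (x q) (4 + 2 * h) OnP → y ⟶ x i → Adj (x q) y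
    adj-out {y} out p r = swap (adj (join (point y) r p λ { refl v∈ → outside-OnP out v∈ refl }))

  -- The vertices of P whose index has the parity of b are x (b + 2 * s) for s ≤ 3 + h.
  module Side (b : ℕ) (b≤1 : b ≤ 1) (y : V) (out : Outside y) where

    In Out AdjS : ℕ → Set
    In s   = x (b + 2 * s) ⟶ y
    Out s  = y ⟶ x (b + 2 * s)
    AdjS s = In s ⊎ Out s

    abstract

      index≤ : ∀ s → s ≤ 3 + h → b + 2 * s ≤ 7 + 2 * h
      index≤ s s≤ = linear 0 (+-mono-≤ b≤1 (+-mono-≤ s≤ s≤))
          (solve 3 (λ b s h → b :+ con 2 :* s :+ (con 4 :+ (h :+ (con 3 :+ h))) :+ con 0 := b :+ (s :+ s) :+ (con 7 :+ con 2 :* h)) refl b s h)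

      -- `down-4+` gives the adjacency. An arc from `y` would complete a shortcut through `y`,
      -- because the indices differ by at least four. Between neighbours of the class the difference
      -- is two, no shortcut arises, and `in-next` leaves the direction open.
      in-up : ∀ s s′ → 2 + s ≤ s′ → s′ ≤ 3 + h → In s → In s′
      in-up s s′ 2+s≤ s′≤ i with remainder 2+s≤
      ... | c , refl with adj-in out (down-4+ c (b + 2 * s) {b + 2 * (2 + s + c)}
          (solve 3 (λ b s c → b :+ con 2 :* (con 2 :+ (s :+ c)) := con 4 :+ (con 2 :* c :+ (b :+ con 2 :* s))) refl b s c) (index≤ _ s′≤)) i
      ...   | inj₁ r = r
      ...   | inj₂ r = contradiction r (short₂ {b + 2 * s} {b + 2 * (2 + s + c)} (slack (1 + 2 * c)
          (solve 3 (λ b s c → con 3 :+ (b :+ con 2 :* s :+ (con 1 :+ con 2 :* c)) := b :+ con 2 :* (con 2 :+ (s :+ c))) refl b s c)) (index≤ _ s′≤) out i)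

      out-down : ∀ s s′ → 2 + s′ ≤ s → s ≤ 3 + h → Out s → Out s′
      out-down s s′ 2+s≤ s≤ o with remainder 2+s≤
      ... | c , refl with adj-out out (down-4+ c (b + 2 * s′) {b + 2 * (2 + s′ + c)}
          (solve 3 (λ b s′ c → b :+ con 2 :* (con 2 :+ (s′ :+ c)) := con 4 :+ (con 2 :* c :+ (b :+ con 2 :* s′))) refl b s′ c) (index≤ _ s≤)) o
      ...   | inj₂ r = r
      ...   | inj₁ r = contradiction o (short₂ {b + 2 * s′} {b + 2 * (2 + s′ + c)} (slack (1 + 2 * c)
          (solve 3 (λ b s′ c → con 3 :+ (b :+ con 2 :* s′ :+ (con 1 :+ con 2 :* c)) := b :+ con 2 :* (con 2 :+ (s′ :+ c))) refl b s′ c)) (index≤ _ s≤) out r)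

      double-suc : ∀ s → 2 + (b + 2 * s) ≡ b + 2 * suc s
      double-suc s = solve 2 (λ b s → con 2 :+ (b :+ con 2 :* s) := b :+ con 2 :* (con 1 :+ s)) refl b s

      in-next : ∀ s → suc s ≤ 3 + h → In s → AdjS (suc s)
      in-next s s≤ i = subst (λ j → Adj (x j) y) (double-suc s)
        (adj-in out (down-2 (b + 2 * s) (subst (_≤ 7 + 2 * h) (sym (double-suc s)) (index≤ (suc s) s≤))) i)

      out-prev : ∀ s → suc s ≤ 3 + h → Out (suc s) → AdjS s
      out-prev s s≤ o = adj-out out (down-2 (b + 2 * s) (subst (_≤ 7 + 2 * h) (sym (double-suc s)) (index≤ (suc s) s≤)))
        (subst (λ j → y ⟶ x j) (sym (double-suc s)) o)

      in-high : ∀ s → s ≤ 1 → In (2 + h + s) → AdjS s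
      in-high s s≤ i = adj-in out (up (b + 2 * s) (4 + 2 * h) {b + 2 * (2 + h + s)}
          (solve 3 (λ b s h → b :+ con 2 :* (con 2 :+ (h :+ s)) := b :+ con 2 :* s :+ (con 4 :+ con 2 :* h)) refl b s h)
        (index≤ _ (≤-trans (+-monoʳ-≤ (2 + h) s≤) (≤-reflexive (+-comm (2 + h) 1))))) i

      out-low : ∀ s → s ≤ 1 → Out s → AdjS (2 + h + s)
      out-low s s≤ o = adj-out out (up (b + 2 * s) (4 + 2 * h) {b + 2 * (2 + h + s)}
          (solve 3 (λ b s h → b :+ con 2 :* (con 2 :+ (h :+ s)) := b :+ con 2 :* s :+ (con 4 :+ con 2 :* h)) refl b s h)
        (index≤ _ (≤-trans (+-monoʳ-≤ (2 + h) s≤) (≤-reflexive (+-comm (2 + h) 1))))) o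

    Touched SomeIn SomeOut NoIn NoOut AllIn AllOut : Set
    Touched = ∃ λ s → s ≤ 3 + h × AdjS s
    SomeIn  = ∃ λ s → s ≤ 3 + h × In s
    SomeOut = ∃ λ s → s ≤ 3 + h × Out s
    NoIn    = ∀ s → s ≤ 3 + h → ¬ In s
    NoOut   = ∀ s → s ≤ 3 + h → ¬ Out s
    AllIn   = ∀ s → s ≤ 3 + h → In s
    AllOut  = ∀ s → s ≤ 3 + h → Out s

    abstract

      untouched : NoIn → NoOut → ¬ Touched
      untouched n m (s , s≤ , inj₁ i) = n s s≤ i
      untouched n m (s , s≤ , inj₂ o) = m s s≤ o

      someIn? : SomeIn ⊎ NoIn
      someIn? with anyUpTo? (λ s → x (b + 2 * s) ⟶? y) (4 + h)
      ... | yes (s , s< , r) = inj₁ (s , s≤s⁻¹ s< , r)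
      ... | no none          = inj₂ λ s s≤ r → none (s , s≤s s≤ , r)

      someOut? : SomeOut ⊎ NoOut
      someOut? with anyUpTo? (λ s → y ⟶? x (b + 2 * s)) (4 + h)
      ... | yes (s , s< , r) = inj₁ (s , s≤s⁻¹ s< , r)
      ... | no none          = inj₂ λ s s≤ r → none (s , s≤s s≤ , r)

      -- `in-up` moves by at least two, so `2 + h` is the only lower position from which it cannot
      -- reach the top one, `3 + h`.
      high-in : SomeIn → In (2 + h) ⊎ In (3 + h)
      high-in (s , s≤ , i) with m≤n⇒m<n∨m≡n s≤
      ... | inj₂ refl = inj₂ i
      ... | inj₁ (s≤s s≤2+h) with m≤n⇒m<n∨m≡n s≤2+h
      ...   | inj₂ refl = inj₁ i
      ...   | inj₁ (s≤s s≤1+h) = inj₂ (in-up s (3 + h) (s≤s (s≤s s≤1+h)) ≤-refl i)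

      low-out : SomeOut → Out 0 ⊎ Out 1
      low-out (0 , _ , o) = inj₁ o
      low-out (1 , _ , o) = inj₂ o
      low-out (suc (suc s) , s≤ , o) = inj₁ (out-down (2 + s) 0 (s≤s (s≤s z≤n)) s≤ o)

      -- Since no arc enters `y`, each adjacency is an arc out. It moves down by one with `out-prev`
      -- and wraps from 0 to `2 + h` and from 1 to `3 + h` with `out-low`; from the top it descends
      -- to every position.
      all-out : NoIn → Touched → AllOut
      all-out none (s₀ , s₀≤ , a) = climb
        where
        use : ∀ {s} → s ≤ 3 + h → AdjS s → Out s
        use s≤ (inj₁ i) = contradiction i (none _ s≤)
        use s≤ (inj₂ o) = o
        down : ∀ s → s ≤ 3 + h → Out s → Out 0
        down zero    _  o = o
        down (suc s) s≤ o = down s (<⇒≤ s≤) (use (<⇒≤ s≤) (out-prev s s≤ o))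
        out0 : Out 0
        out0 = down s₀ s₀≤ (use s₀≤ a)
        below : ∀ t s → s + t ≤ 3 + h → Out (s + t) → Out s
        below zero    s _   o = subst Out (+-identityʳ s) o
        below (suc t) s st≤ o = use (m+n≤o⇒m≤o s st≤) (out-prev s (m+n≤o⇒m≤o (suc s) st≤′) (below t (suc s) st≤′ (subst Out (+-suc s t) o)))
          where
          st≤′ : suc s + t ≤ 3 + h
          st≤′ = subst (_≤ 3 + h) (+-suc s t) st≤
        out-2+h : Out (2 + h)
        out-2+h = use (n≤1+n _) (subst AdjS (+-identityʳ (2 + h)) (out-low 0 z≤n out0))
        out-1 : Out 1
        out-1 = below (1 + h) 1 (n≤1+n _) out-2+h
        out-3+h : Out (3 + h)
        out-3+h = use ≤-refl (subst AdjS (+-comm (2 + h) 1) (out-low 1 ≤-refl out-1))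
        climb : AllOut
        climb s s≤ with remainder s≤
        ... | t , e = below t s (≤-reflexive e) (subst Out (sym e) out-3+h)

      all-in : NoOut → Touched → AllIn
      all-in none (s₀ , s₀≤ , a) = climb
        where
        use : ∀ {s} → s ≤ 3 + h → AdjS s → In s
        use s≤ (inj₁ i) = i
        use s≤ (inj₂ o) = contradiction o (none _ s≤)
        above : ∀ t s → s + t ≤ 3 + h → In s → In (s + t)
        above zero    s _   i = subst In (sym (+-identityʳ s)) i
        above (suc t) s st≤ i = subst In (sym (+-suc s t)) (above t (suc s) st≤′ (use s< (in-next s s< i)))
          where
          st≤′ : suc s + t ≤ 3 + h
          st≤′ = subst (_≤ 3 + h) (+-suc s t) st≤
          s< : suc s ≤ 3 + h
          s< = m+n≤o⇒m≤o (suc s) st≤′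
        in-3+h : In (3 + h)
        in-3+h with remainder s₀≤
        ... | t , e = subst In e (above t s₀ (≤-reflexive e) (use s₀≤ a))
        in-1 : In 1
        in-1 = use (s≤s z≤n) (in-high 1 ≤-refl (subst In (+-comm 1 (2 + h)) in-3+h))
        in-0 : In 0
        in-0 = use z≤n (in-high 0 z≤n (subst In (sym (+-identityʳ (2 + h))) (above (1 + h) 1 (n≤1+n _) in-1)))
        climb : AllIn
        climb s s≤ = above s 0 s≤ in-0

  -- Two outside vertices joined through P

  abstract

    -- P contributes `3 + 2 * h = k - 2` arcs, and the arcs at `y` and `z` complete the length k.
    cross-path : ∀ {i j y z} → Outside y → Outside z → y ≢ z → SPath (x i) (x j) (3 + 2 * h) OnP →
                 y ⟶ x i → x j ⟶ z → Adj y z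
    cross-path {y = y} {z} outY outZ y≢z p r r′ = adj (resize (+-comm _ 1)
      (join (join (point y) r p λ { refl v∈ → outside-OnP outY v∈ refl }) r′ (point z)
        λ { (inj₁ refl) e → y≢z e ; (inj₂ v∈) refl → outside-OnP outZ v∈ refl }))

  -- The k - 2 arcs inside P are odd in number. Hence `y` is studied at the even and `z` at the odd
  -- indices.
  module Cross {y z : V} (outY : Outside y) (outZ : Outside z) (y≢z : y ≢ z) where

    module Y = Side 0 z≤n y outY
    module Z = Side 1 ≤-refl z outZ

    abstract

      up-yz : ∀ s → s ≤ 2 → Y.Out s → Z.In (s + (1 + h)) → Adj y z
      up-yz s s≤ o i = cross-path outY outZ y≢z (up (2 * s) (3 + 2 * h) {1 + 2 * (s + (1 + h))}
          (solve 2 (λ s h → con 1 :+ con 2 :* (s :+ (con 1 :+ h)) := con 2 :* s :+ (con 3 :+ con 2 :* h)) refl s h)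
        (Z.index≤ _ (+-monoˡ-≤ (1 + h) s≤))) o i

      up-zy : ∀ s → s ≤ 1 → Z.Out s → Y.In (s + (2 + h)) → Adj y z
      up-zy s s≤ o i = swap (cross-path outZ outY (y≢z ∘ sym) (up (1 + 2 * s) (3 + 2 * h) {2 * (s + (2 + h))}
          (solve 2 (λ s h → con 2 :* (s :+ (con 2 :+ h)) := con 1 :+ (con 2 :* s :+ (con 3 :+ con 2 :* h))) refl s h)
        (Y.index≤ _ (+-monoˡ-≤ (2 + h) s≤))) o i)

      down-1 : Y.Out (2 + h) → Z.In (1 + h) → Adj y z
      down-1 o i = cross-path outY outZ y≢z (sized
        (onP (block {2 * (2 + h)} {2 * (2 + h)} 0 (back {2 * (2 + h)} 1 h
            (solve 1 (λ h → con 2 :* (con 2 :+ h) := con 3 :+ (con 2 :* h :+ con 1)) refl h) (Y.index≤ (2 + h) (n≤1+n _))) (+-identityʳ _) (Y.index≤ (2 + h) (n≤1+n _))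
          (base {1} {1 + 2 * (1 + h)} (2 * (1 + h)) refl (Z.index≤ (1 + h) (m≤n+m (1 + h) 2))) (slack 0
              (solve 1 (λ h → con 2 :+ (con 2 :* (con 1 :+ h) :+ con 0) := con 2 :* (con 2 :+ h)) refl h)) (s≤s z≤n)) (Y.index≤ (2 + h) (n≤1+n _)))
              (solve 1 (λ h → con 1 :+ con 2 :* (con 1 :+ h) := con 3 :+ con 2 :* h) refl h)) o i

      down-3 : Y.Out (2 + h) → Z.In h → Adj y z
      down-3 o i = cross-path outY outZ y≢z
        (onP (block {2 * (2 + h)} {5 + 2 * h} 1 (back-k 0 refl (slack 2
            (solve 1 (λ h → con 5 :+ (con 2 :* h :+ con 2) := con 7 :+ con 2 :* h) refl h)))
            (solve 1 (λ h → con 2 :* (con 2 :+ h) :+ con 1 := con 5 :+ con 2 :* h) refl h) (slack 2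
            (solve 1 (λ h → con 5 :+ (con 2 :* h :+ con 2) := con 7 :+ con 2 :* h) refl h))
          (base {0} {1 + 2 * h} (1 + 2 * h) refl (Z.index≤ h (m≤n+m h 3))) (slack 2
              (solve 1 (λ h → con 2 :+ (con 2 :* h :+ con 2) := con 2 :* (con 2 :+ h)) refl h)) z≤n) (slack 2
              (solve 1 (λ h → con 5 :+ (con 2 :* h :+ con 2) := con 7 :+ con 2 :* h) refl h))) o i

      down-5 : Y.Out (3 + h) → Z.In h → Adj y z
      down-5 o i = cross-path outY outZ y≢z
        (onP (block {2 * (3 + h)} {7 + 2 * h} 1 back-N-0
            (solve 1 (λ h → con 2 :* (con 3 :+ h) :+ con 1 := con 7 :+ con 2 :* h) refl h) ≤-refl
          (base {0} {1 + 2 * h} (1 + 2 * h) refl (Z.index≤ h (m≤n+m h 3))) (slack 4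
              (solve 1 (λ h → con 2 :+ (con 2 :* h :+ con 4) := con 2 :* (con 3 :+ h)) refl h)) z≤n) ≤-refl) o i

      case-A₁ : Z.SomeOut → Y.Out 0 → Y.In (2 + h) → Adj y z
      case-A₁ zo o i with Z.low-out zo
      ... | inj₁ o′ = up-zy 0 z≤n o′ i
      ... | inj₂ o′ with Z.out-prev 0 (s≤s z≤n) o′ | Y.in-next (2 + h) ≤-refl i
      ...   | inj₂ o″ | _       = up-zy 0 z≤n o″ i
      ...   | inj₁ _  | inj₁ i′ = up-zy 1 ≤-refl o′ i′
      ...   | inj₁ i″ | inj₂ o₃ with m≤n⇒m<n∨m≡n (z≤n {h})
      ...     | inj₁ 1≤h = up-yz 0 z≤n o (Z.in-up 0 (1 + h) (s≤s 1≤h) (m≤n+m (1 + h) 2) i″)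
      -- With `h = 0`, `in-up` cannot lead from 0 to `1 + h`, but then 0 is the position `h` that
      -- `down-5` asks for.
      ...     | inj₂ 0≡h = down-5 o₃ (subst Z.In 0≡h i″)

      -- For `h ≥ 2` the arc is lifted to position `1 + h`. A lift by `h = 1` is too short for
      -- `in-up`; in that case the position 1 equals `h` and `down-3` takes over.
      in-z-1 : Y.Out (2 + h) → Z.In 1 → Adj y z
      in-z-1 o i with m≤n⇒m<n∨m≡n (z≤n {h})
      ... | inj₂ 0≡h = down-1 o (subst Z.In (cong suc 0≡h) i)
      ... | inj₁ 1≤h with m≤n⇒m<n∨m≡n 1≤h
      ...   | inj₂ 1≡h = down-3 o (subst Z.In 1≡h i)
      ...   | inj₁ 2≤h = down-1 o (Z.in-up 1 (1 + h) (s≤s 2≤h) (m≤n+m (1 + h) 2) i)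

      case-A : Y.SomeIn → Z.SomeOut → Y.Out 0 → Z.In (3 + h) → Adj y z
      case-A yi zo o i with subst Y.AdjS (+-identityʳ (2 + h)) (Y.out-low 0 z≤n o) | Z.in-high 1 ≤-refl (subst Z.In (+-comm 1 (2 + h)) i)
      ... | inj₁ i₂ | _       = case-A₁ zo o i₂
      ... | inj₂ o₂ | inj₁ i₁ = in-z-1 o₂ i₁
      ... | inj₂ o₂ | inj₂ o₁ with Y.high-in yi
      ...   | inj₁ i₂ = case-A₁ zo o i₂
      ...   | inj₂ i₃ = up-zy 1 ≤-refl o₁ i₃

      -- The arcs out of `y` and into `z` may be taken near the bottom and near the top of P. If
      -- their distance is not k - 2, neighbouring positions are adjacent as well, and each possible
      -- direction there gives a fitting pair of arcs, possibly one that leads from `z` to `y`.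
      mixed-adjacent : Y.SomeIn → Y.SomeOut → Z.SomeIn → Z.SomeOut → Adj y z
      mixed-adjacent yi yo zi zo = cases (Y.low-out yo) (Z.high-in zi)
        where
        cases : Y.Out 0 ⊎ Y.Out 1 → Z.In (2 + h) ⊎ Z.In (3 + h) → Adj y z
        cases (inj₁ o) (inj₂ i) = case-A yi zo o i
        cases (inj₂ o) (inj₁ i) = up-yz 1 (s≤s z≤n) o i
        cases (inj₂ o) (inj₂ i) with Y.out-prev 0 (s≤s z≤n) o
        ... | inj₂ o₀ = case-A yi zo o₀ i
        ... | inj₁ i₀ with Z.low-out zo
        ...   | inj₁ o′ = up-zy 0 z≤n o′ (Y.in-up 0 (2 + h) (m≤m+n 2 h) (n≤1+n _) i₀)
        ...   | inj₂ o′ with Z.out-prev 0 (s≤s z≤n) o′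
        ...     | inj₂ o″ = up-zy 0 z≤n o″ (Y.in-up 0 (2 + h) (m≤m+n 2 h) (n≤1+n _) i₀)
        ...     | inj₁ i″ = up-yz 1 (s≤s z≤n) o (Z.in-up 0 (2 + h) (m≤m+n 2 h) (n≤1+n _) i″)
        cases (inj₁ o) (inj₁ i) with Z.in-next (2 + h) ≤-refl i
        ... | inj₁ i₃ = case-A yi zo o i₃
        ... | inj₂ o₃ with Y.high-in yi
        ...   | inj₁ i₂ = up-zy 0 z≤n (Z.out-down (3 + h) 0 (m≤m+n 2 (1 + h)) ≤-refl o₃) i₂
        ...   | inj₂ i₃ = up-zy 1 ≤-refl (Z.out-down (3 + h) 1 (m≤m+n 3 h) ≤-refl o₃) i₃

      -- If a direction is missing at exactly one of the vertices, that vertex has all arcs of the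
      -- other direction. So whichever arc `high-in` or `low-out` finds at the other vertex has a
      -- partner at the right distance.
      adjacent-or-one-sided : Y.Touched → Z.Touched → Adj y z ⊎ (Y.NoIn × Z.NoIn) ⊎ (Y.NoOut × Z.NoOut)
      adjacent-or-one-sided yt zt with Y.someIn? | Z.someIn? | Y.someOut? | Z.someOut?
      ... | inj₂ ni | inj₂ ni′ | _ | _ = inj₂ (inj₁ (ni , ni′))
      ... | inj₁ yi | inj₂ ni′ | _ | _ with Y.high-in yi
      ...   | inj₁ i = inj₁ (up-zy 0 z≤n (Z.all-out ni′ zt 0 z≤n) i)
      ...   | inj₂ i = inj₁ (up-zy 1 ≤-refl (Z.all-out ni′ zt 1 (s≤s z≤n)) i)
      adjacent-or-one-sided yt zt | inj₂ ni | inj₁ zi | _ | _ with Z.high-in zi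
      ...   | inj₁ i = inj₁ (up-yz 1 (s≤s z≤n) (Y.all-out ni yt 1 (s≤s z≤n)) i)
      ...   | inj₂ i = inj₁ (up-yz 2 ≤-refl (Y.all-out ni yt 2 (s≤s (s≤s z≤n))) i)
      adjacent-or-one-sided yt zt | inj₁ _ | inj₁ _ | inj₂ my | inj₂ mz = inj₂ (inj₂ (my , mz))
      adjacent-or-one-sided yt zt | inj₁ _ | inj₁ _ | inj₁ yo | inj₂ mz with Y.low-out yo
      ...   | inj₁ o = inj₁ (up-yz 0 z≤n o (Z.all-in mz zt (1 + h) (m≤n+m (1 + h) 2)))
      ...   | inj₂ o = inj₁ (up-yz 1 (s≤s z≤n) o (Z.all-in mz zt (2 + h) (n≤1+n _)))
      adjacent-or-one-sided yt zt | inj₁ _ | inj₁ _ | inj₂ my | inj₁ zo with Z.low-out zo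
      ...   | inj₁ o = inj₁ (up-zy 0 z≤n o (Y.all-in my yt (2 + h) (n≤1+n _)))
      ...   | inj₂ o = inj₁ (up-zy 1 ≤-refl o (Y.all-in my yt (3 + h) ≤-refl))
      adjacent-or-one-sided yt zt | inj₁ yi | inj₁ zi | inj₁ yo | inj₁ zo = inj₁ (mixed-adjacent yi yo zi zo)

  -- Outside vertices adjacent to both parities

  SomeEvenBackArc : Set
  SomeEvenBackArc = ∃ λ i → ∃ λ d → EvenBackArc i d

  abstract

    -- The two arcs at `y` extend k - 2 arcs of P to a path of length k from `x q` to `x o`. The
    -- part in P avoids the indices 0 to 3, which leaves them free for the arc from `y`: `low-out`
    -- provides one of these.
    detour : ∀ {i q y} o d → Outside y → SPath (x q) (x i) (3 + 2 * h) (I 4 (7 + 2 * h)) → x i ⟶ y → y ⟶ x o →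
             o ≤ 3 → q ≡ 2 + 2 * d + o → q ≤ 7 + 2 * h → SomeEvenBackArc
    detour {y = y} o d out p r r′ o≤ refl q≤ = o , d , q≤ , back-arc
      (join (join p r (point y) λ { (at l _ l≤ refl) → out l l≤ }) r′ (point (x o))
        λ { (inj₁ (at l 4≤ l≤ refl)) e → inj o l (≤-trans (s≤s o≤) 4≤) l≤ (sym e)
          ; (inj₂ refl) e → out o (≤-trans o≤ (m≤m+n 3 (4 + 2 * h))) (sym e) })
      (solve 1 (λ h → con 3 :+ (con 2 :* h :+ con 1 :+ con 1) := con 5 :+ con 2 :* h) refl h) (slack (2 * d)
          (solve 2 (λ o d → con 2 :+ (o :+ con 2 :* d) := con 2 :+ (con 2 :* d :+ o)) refl o d)) q≤

    into-k-1 : SPath (x (5 + 2 * h)) (x (4 + 2 * h)) (3 + 2 * h) (I 4 (7 + 2 * h))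
    into-k-1 = block {5 + 2 * h} 2 (back-from-N {4} 2 refl (m≤m+n 4 (1 + 2 * h))) (+-comm _ 2) ≤-refl
      (base {4} (2 * h) refl (slack 3
          (solve 1 (λ h → con 4 :+ (con 2 :* h :+ con 3) := con 7 :+ con 2 :* h) refl h))) ≤-refl (m≤m+n 4 (1 + 2 * h))

    into-k : SPath (x (6 + 2 * h)) (x (5 + 2 * h)) (3 + 2 * h) (I 4 (7 + 2 * h))
    into-k = block {6 + 2 * h} 1 (back-from-N {4} 2 refl (m≤m+n 4 (1 + 2 * h))) (+-comm _ 1) ≤-refl
      (base {4} (1 + 2 * h) refl (slack 2
          (solve 1 (λ h → con 5 :+ (con 2 :* h :+ con 2) := con 7 :+ con 2 :* h) refl h))) ≤-refl (m≤m+n 4 (2 + 2 * h))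

    into-k+1 : SPath (x (7 + 2 * h)) (x (6 + 2 * h)) (3 + 2 * h) (I 4 (7 + 2 * h))
    into-k+1 = block {7 + 2 * h} 0 (back-from-N {4} 2 refl (m≤m+n 4 (1 + 2 * h))) (+-identityʳ _) ≤-refl
      (base {4} (2 + 2 * h) refl (n≤1+n _)) ≤-refl (m≤m+n 4 (3 + 2 * h))

    into-k+2 : SPath (x 4) (x (7 + 2 * h)) (3 + 2 * h) (I 4 (7 + 2 * h))
    into-k+2 = base {4} (3 + 2 * h) refl ≤-refl

  module Both {y : V} (out : Outside y) where

    module S₀ = Side 0 z≤n y out
    module S₁ = Side 1 ≤-refl y out

    abstract

      in-0-out-1 : S₀.SomeIn → S₁.SomeOut → SomeEvenBackArc
      in-0-out-1 si so with S₀.high-in si | S₁.low-out so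
      ... | inj₁ i | inj₁ o = detour 1 (1 + h) out into-k-1 (subst (λ j → x j ⟶ y) ((2 * (2 + h) ≡ 4 + 2 * h) ∋ solve 1 (λ h → con 2 :* (con 2 :+ h) := con 4 :+ con 2 :* h) refl h) i) o (s≤s z≤n)
          (solve 1 (λ h → con 5 :+ con 2 :* h := con 2 :+ (con 2 :* (con 1 :+ h) :+ con 1)) refl h) (slack 2
          (solve 1 (λ h → con 5 :+ (con 2 :* h :+ con 2) := con 7 :+ con 2 :* h) refl h))
      ... | inj₁ i | inj₂ o = detour 3 h out into-k-1 (subst (λ j → x j ⟶ y) ((2 * (2 + h) ≡ 4 + 2 * h) ∋ solve 1 (λ h → con 2 :* (con 2 :+ h) := con 4 :+ con 2 :* h) refl h) i) o ≤-refl
          (solve 1 (λ h → con 5 :+ con 2 :* h := con 2 :+ (con 2 :* h :+ con 3)) refl h) (slack 2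
          (solve 1 (λ h → con 5 :+ (con 2 :* h :+ con 2) := con 7 :+ con 2 :* h) refl h))
      ... | inj₂ i | inj₁ o = detour 1 (2 + h) out into-k+1 (subst (λ j → x j ⟶ y) ((2 * (3 + h) ≡ 6 + 2 * h) ∋ solve 1 (λ h → con 2 :* (con 3 :+ h) := con 6 :+ con 2 :* h) refl h) i) o (s≤s z≤n)
          (solve 1 (λ h → con 7 :+ con 2 :* h := con 2 :+ (con 2 :* (con 2 :+ h) :+ con 1)) refl h) ≤-refl
      ... | inj₂ i | inj₂ o = detour 3 (1 + h) out into-k+1 (subst (λ j → x j ⟶ y) ((2 * (3 + h) ≡ 6 + 2 * h) ∋ solve 1 (λ h → con 2 :* (con 3 :+ h) := con 6 :+ con 2 :* h) refl h) i) o ≤-refl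
          (solve 1 (λ h → con 7 :+ con 2 :* h := con 2 :+ (con 2 :* (con 1 :+ h) :+ con 3)) refl h) ≤-refl

      in-1-out-0 : S₁.SomeIn → S₀.SomeOut → SomeEvenBackArc
      in-1-out-0 si so with S₁.high-in si | S₀.low-out so
      ... | inj₁ i | inj₁ o = detour 0 (2 + h) out into-k (subst (λ j → x j ⟶ y) ((1 + 2 * (2 + h) ≡ 5 + 2 * h) ∋ solve 1 (λ h → con 1 :+ con 2 :* (con 2 :+ h) := con 5 :+ con 2 :* h) refl h) i) o z≤n
          (solve 1 (λ h → con 6 :+ con 2 :* h := con 2 :+ (con 2 :* (con 2 :+ h) :+ con 0)) refl h) (n≤1+n _)
      ... | inj₁ i | inj₂ o = detour 2 (1 + h) out into-k (subst (λ j → x j ⟶ y) ((1 + 2 * (2 + h) ≡ 5 + 2 * h) ∋ solve 1 (λ h → con 1 :+ con 2 :* (con 2 :+ h) := con 5 :+ con 2 :* h) refl h) i) o (s≤s (s≤s z≤n))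
          (solve 1 (λ h → con 6 :+ con 2 :* h := con 2 :+ (con 2 :* (con 1 :+ h) :+ con 2)) refl h) (n≤1+n _)
      ... | inj₂ i | inj₁ o = detour 0 1 out into-k+2 (subst (λ j → x j ⟶ y) ((1 + 2 * (3 + h) ≡ 7 + 2 * h) ∋ solve 1 (λ h → con 1 :+ con 2 :* (con 3 :+ h) := con 7 :+ con 2 :* h) refl h) i) o z≤n refl (m≤m+n 4 (3 + 2 * h))
      ... | inj₂ i | inj₂ o = detour 2 0 out into-k+2 (subst (λ j → x j ⟶ y) ((1 + 2 * (3 + h) ≡ 7 + 2 * h) ∋ solve 1 (λ h → con 1 :+ con 2 :* (con 3 :+ h) := con 7 :+ con 2 :* h) refl h) i) o (s≤s (s≤s z≤n)) refl (m≤m+n 4 (3 + 2 * h))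

    Absorbing Emitting : Set
    Absorbing = ∀ l → l ≤ 7 + 2 * h → x l ⟶ y × ¬ y ⟶ x l
    Emitting  = ∀ l → l ≤ 7 + 2 * h → y ⟶ x l × ¬ x l ⟶ y

    abstract

      by-parity : ∀ {Q : ℕ → Set} → (∀ s → s ≤ 3 + h → Q (2 * s)) → (∀ s → s ≤ 3 + h → Q (1 + 2 * s)) →
                  ∀ l → l ≤ 7 + 2 * h → Q l
      by-parity {Q} q₀ q₁ l l≤ with halve l
      ... | a , 0 , _ , refl , _ = subst Q (sym (+-identityʳ (2 * a))) (q₀ a (s≤s⁻¹ (*-cancelˡ-< 2 a (4 + h) (linear 0 l≤
          (solve 2 (λ a h → con 1 :+ (con 2 :* a :+ (con 7 :+ con 2 :* h) :+ con 0) := con 2 :* a :+ con 0 :+ con 2 :* (con 4 :+ h)) refl a h)))))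
      ... | a , 1 , _ , refl , _ = subst Q (+-comm 1 (2 * a)) (q₁ a (s≤s⁻¹ (*-cancelˡ-< 2 a (4 + h) (linear 1 l≤
          (solve 2 (λ a h → con 1 :+ (con 2 :* a :+ (con 7 :+ con 2 :* h) :+ con 1) := con 2 :* a :+ con 1 :+ con 2 :* (con 4 :+ h)) refl a h)))))
      ... | a , suc (suc _) , _ , _ , ()

      absorbing : S₀.NoOut → S₁.NoOut → S₀.Touched → S₁.Touched → Absorbing
      absorbing n₀ n₁ t₀ t₁ = by-parity (λ s s≤ → S₀.all-in n₀ t₀ s s≤ , n₀ s s≤) (λ s s≤ → S₁.all-in n₁ t₁ s s≤ , n₁ s s≤)

      emitting : S₀.NoIn → S₁.NoIn → S₀.Touched → S₁.Touched → Emitting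
      emitting n₀ n₁ t₀ t₁ = by-parity (λ s s≤ → S₀.all-out n₀ t₀ s s≤ , n₀ s s≤) (λ s s≤ → S₁.all-out n₁ t₁ s s≤ , n₁ s s≤)

      -- Suppose no even back arc arises. An arc from an even index to `y` then rules out arcs from
      -- `y` to odd ones, so the adjacency at the odd indices is an arc to `y`, which in turn rules
      -- out arcs from `y` to even ones: all arcs point to `y`. Without arcs from even indices the
      -- argument runs the other way.
      classify : S₀.Touched → S₁.Touched → SomeEvenBackArc ⊎ Absorbing ⊎ Emitting
      classify t₀ t₁ with S₀.someIn? | S₁.someIn? | S₀.someOut? | S₁.someOut?
      ... | inj₁ i₀ | _ | _ | inj₁ o₁ = inj₁ (in-0-out-1 i₀ o₁)
      ... | _ | inj₁ i₁ | inj₁ o₀ | _ = inj₁ (in-1-out-0 i₁ o₀)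
      ... | _ | _ | inj₂ n₀ | inj₂ n₁ = inj₂ (inj₁ (absorbing n₀ n₁ t₀ t₁))
      ... | inj₂ n₀ | inj₂ n₁ | _ | _ = inj₂ (inj₂ (emitting n₀ n₁ t₀ t₁))
      ... | _ | inj₂ n₁ | _ | inj₂ m₁ = contradiction t₁ (S₁.untouched n₁ m₁)
      ... | inj₂ n₀ | _ | inj₂ m₀ | _ = contradiction t₀ (S₀.untouched n₀ m₀)

  -- Colours of the vertices outside P

  C : Parity → Pred V 0ℓ
  C β v = ∃ λ l → l ≤ 7 + 2 * h × parity l ≡ β × v ≡ x l

  P : Pred V 0ℓ
  P v = ∃ λ γ → C γ v

  abstract

    outside : ∀ {y} → ¬ P y → Outside y
    outside y∉P l l≤ e = y∉P (parity l , l , l≤ , refl , sym e)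

    OnP⊆P : OnP ⊆ P
    OnP⊆P (at l _ l≤ e) = parity l , l , l≤ , refl , e

    parity-difference : ∀ q r l c → q + (r + l) ≡ 2 * c → parity q ≡ parity r ℙ.+ parity l
    parity-difference q r l c e = trans (same-parity q (r + l) c e) (+-homo-+ r l)

    -- By walking along the cycle that `back-N-0` closes. Its length k + 3 is even, so the parity
    -- alternates across the closing arc too.
    into : ∀ {β v} r → r ≤ 4 + 2 * h → C β v → ∃ λ u → C (parity r ℙ.+ β) u × SPath u v r P
    into r r≤ (l , l≤ , refl , refl) with r ≤? l
    ... | yes r≤l with remainder r≤l
    ...   | q , refl = x q , (q , ≤-trans (m≤n+m q r) l≤ , parity-difference q r (r + q) (q + r)
        (solve 2 (λ q r → q :+ (r :+ (r :+ q)) := con 2 :* (q :+ r)) refl q r) , refl)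
                     , weaken OnP⊆P (up q r {r + q} (+-comm r q) l≤)
    into r r≤ (l , l≤ , refl , refl) | no r≰l with remainder (≰⇒> r≰l)
    ... | t , refl with remainder {t} {7 + 2 * h} (linear (4 + l) r≤
        (solve 3 (λ l t h → t :+ (con 4 :+ con 2 :* h) :+ (con 4 :+ l) := con 1 :+ (l :+ t :+ (con 7 :+ con 2 :* h))) refl l t h))
    ...   | q , e = x q , (q , m+n≤o⇒n≤o t (≤-reflexive e)
                          , parity-difference q (suc l + t) l (4 + h + l) (balance e
                              (solve 4 (λ q l t h → q :+ (con 1 :+ (l :+ t :+ l)) :+ (con 7 :+ con 2 :* h) := t :+ q :+ con 2 :* (con 4 :+ (h :+ l))) refl q l t h)) , refl)
                  , sized (weaken OnP⊆P (onP (block {q} t back-N-0 (trans (+-comm q t) e) ≤-refl (base {0} l refl l≤)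
                      (linear 3 (+-mono-≤ r≤ (≤-reflexive (sym e)))
                          (solve 4 (λ l t q h → con 1 :+ (l :+ (con 4 :+ (con 2 :* h :+ (t :+ q))) :+ con 3) := con 1 :+ (l :+ t :+ (con 7 :+ con 2 :* h) :+ q)) refl l t q h)) z≤n) ≤-refl))
                    ((t + suc l ≡ suc l + t) ∋ +-comm t (suc l))

    from : ∀ {β v} r → r ≤ 4 + 2 * h → C β v → ∃ λ u → C (parity r ℙ.+ β) u × SPath v u r P
    from r r≤ (l , l≤ , refl , refl) with l + r ≤? 7 + 2 * h
    ... | yes p≤ = x (l + r) , (l + r , p≤ , parity-difference (l + r) r l (l + r)
        (solve 2 (λ l r → l :+ r :+ (r :+ l) := con 2 :* (l :+ r)) refl l r) , refl)
                 , weaken OnP⊆P (up l r refl p≤)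
    ... | no p≰ with remainder (≰⇒> p≰) | remainder l≤
    ...   | p , e | t , e′ = x p , (p , <⇒≤ p<N , parity-difference p r l (4 + h + p) (balance (sym e)
        (solve 4 (λ p r l h → p :+ (r :+ l) :+ (con 8 :+ (con 2 :* h :+ p)) := l :+ r :+ con 2 :* (con 4 :+ (h :+ p))) refl p r l h)) , refl)
                           , sized (weaken OnP⊆P (onP (block {l} t back-N-0 e′ ≤-refl (base {0} p refl (<⇒≤ p<N)) p<l z≤n) ≤-refl))
                               (balance (cong₂ _+_ e e′)
                                   (solve 5 (λ t p l r h → t :+ (con 1 :+ p) :+ (l :+ r :+ (con 7 :+ con 2 :* h)) := con 8 :+ (con 2 :* h :+ p :+ (l :+ t) :+ r)) refl t p l r h))
      where
      p<l : p < l
      p<l = linear 3 (+-mono-≤ r≤ (≤-reflexive e))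
          (solve 4 (λ p l r h → con 1 :+ (p :+ (con 4 :+ (con 2 :* h :+ (l :+ r))) :+ con 3) := r :+ (con 8 :+ (con 2 :* h :+ p)) :+ l) refl p l r h)
      p<N : p < 7 + 2 * h
      p<N = <-≤-trans p<l l≤

    adj-op : ∀ {a b M} → Trails.SPath (flip _⟶_) a b (5 + 2 * h) M → b ⟶ a ⊎ a ⟶ b
    adj-op p = adj (reversePath p)

    into-op : ∀ {β v} r → r ≤ 4 + 2 * h → C β v → ∃ λ u → C (parity r ℙ.+ β) u × Trails.SPath (flip _⟶_) u v r P
    into-op r r≤ c with from r r≤ c
    ... | u , cu , p = u , cu , reversePath p

    from-op : ∀ {β v} r → r ≤ 4 + 2 * h → C β v → ∃ λ u → C (parity r ℙ.+ β) u × Trails.SPath (flip _⟶_) v u r P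
    from-op r r≤ c with into r r≤ c
    ... | u , cu , p = u , cu , reversePath p

  module E  = Exits _≟_ _⟶_ h adj C into from
  module E′ = Exits _≟_ (flip _⟶_) h adj-op C into-op from-op

  abstract

    even-index : ∀ l → l ≤ 7 + 2 * h → parity l ≡ 0ℙ → ∃ λ s → s ≤ 3 + h × l ≡ 2 * s
    even-index l l≤ e with halve l
    ... | a , 0 , _ , refl , _ = a , s≤s⁻¹ (*-cancelˡ-< 2 a (4 + h) (linear 0 l≤
        (solve 2 (λ a h → con 1 :+ (con 2 :* a :+ (con 7 :+ con 2 :* h) :+ con 0) := con 2 :* a :+ con 0 :+ con 2 :* (con 4 :+ h)) refl a h))) , +-identityʳ (2 * a)
    ... | a , 1 , _ , refl , _ with trans (sym e) (trans (+-homo-+ (2 * a) 1) (cong (ℙ._+ 1ℙ) (parity-even a)))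
    ...   | ()
    even-index l l≤ e | a , suc (suc _) , _ , _ , ()

    odd-index : ∀ l → l ≤ 7 + 2 * h → parity l ≡ 1ℙ → ∃ λ s → s ≤ 3 + h × l ≡ 1 + 2 * s
    odd-index l l≤ e with halve l
    ... | a , 1 , _ , refl , _ = a , s≤s⁻¹ (*-cancelˡ-< 2 a (4 + h) (linear 1 l≤
        (solve 2 (λ a h → con 1 :+ (con 2 :* a :+ (con 7 :+ con 2 :* h) :+ con 1) := con 2 :* a :+ con 1 :+ con 2 :* (con 4 :+ h)) refl a h))) , +-comm (2 * a) 1
    ... | a , 0 , _ , refl , _ with trans (sym e) (trans (cong parity (+-identityʳ (2 * a))) (parity-even a))
    ...   | ()
    odd-index l l≤ e | a , suc (suc _) , _ , _ , ()

  module _ {y : V} (out : Outside y) where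

    open Both out using (module S₀; module S₁)

    abstract

      touches-0 : E.AdjC 0ℙ y → S₀.Touched
      touches-0 (_ , (l , l≤ , e , refl) , a) with even-index l l≤ e
      ... | s , s≤ , refl = s , s≤ , a

      touches-1 : E.AdjC 1ℙ y → S₁.Touched
      touches-1 (_ , (l , l≤ , e , refl) , a) with odd-index l l≤ e
      ... | s , s≤ , refl = s , s≤ , a

  abstract

    adjacent-colour : ∀ {y} l → l ≤ 7 + 2 * h → Adj (x l) y → E.AdjC (parity l) y
    adjacent-colour l l≤ a = x l , (l , l≤ , refl , refl) , a

  BothTouched : ∀ {y} → Outside y → Set
  BothTouched out = Both.S₀.Touched out × Both.S₁.Touched out

  abstract

    ends-touched : ∀ {y} (out : Outside y) → Adj (x 0) y → Adj (x 1) y → BothTouched out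
    ends-touched out a₀ a₁ = touches-0 out (adjacent-colour 0 z≤n a₀) , touches-1 out (adjacent-colour 1 (s≤s z≤n) a₁)

    -- The path `x i ⋯ x (i + k - 2) ⟶ u ⟶ w` has length k, and `i = 0, 1` give both colours.
    absorbing-successor : ∀ {u w} (outU : Outside u) (outW : Outside w) → u ⟶ w → Both.Absorbing outU → BothTouched outW
    absorbing-successor {u} {w} outU outW r ab = ends-touched outW (via 0 z≤n) (via 1 ≤-refl)
      where
      via : ∀ i → i ≤ 1 → Adj (x i) w
      via i i≤ = adj (sized (join (join (up i (3 + 2 * h) refl j≤) (proj₁ (ab (i + (3 + 2 * h)) j≤)) (point u)
          λ { v∈ refl → outside-OnP outU v∈ refl }) r (point w)
          λ { (inj₁ v∈) refl → outside-OnP outW v∈ refl ; (inj₂ refl) refl → irrefl _ r })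
          (trans (+-comm _ 1) (cong suc (+-comm _ 1))))
        where
        j≤ : i + (3 + 2 * h) ≤ 7 + 2 * h
        j≤ = linear 3 i≤
            (solve 2 (λ i h → i :+ (con 3 :+ con 2 :* h) :+ con 1 :+ con 3 := i :+ (con 7 :+ con 2 :* h)) refl i h)

    -- The path is `u ⟶ w ⟶ x i ⋯ x (i + k - 2)`. Its end has the parity of `suc i`, so `i = 1`
    -- gives the even colour and `i = 0` the odd one.
    emitting-predecessor : ∀ {u w} (outU : Outside u) (outW : Outside w) → u ⟶ w → Both.Emitting outW → BothTouched outU
    emitting-predecessor {u} {w} outU outW r em = touches-0 outU (colour-of 1 ≤-refl) , touches-1 outU (colour-of 0 z≤n)
      where
      via : ∀ i → i ≤ 1 → i + (3 + 2 * h) ≤ 7 + 2 * h → Adj (x (i + (3 + 2 * h))) u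
      via i i≤ j≤ = swap (adj (join (point u) r (join (point w) (proj₁ (em i (≤-trans (m≤m+n i _) j≤))) (up i (3 + 2 * h) refl j≤)
          λ { refl v∈ → outside-OnP outW v∈ refl })
          λ { refl (inj₁ refl) → irrefl _ r ; refl (inj₂ v∈) → outside-OnP outU v∈ refl }))
      colour-of : ∀ i → i ≤ 1 → E.AdjC (parity (suc i)) u
      colour-of i i≤ = subst (λ p → E.AdjC p u) (same-parity (i + (3 + 2 * h)) (suc i) (2 + h + i)
          (solve 2 (λ i h → i :+ (con 3 :+ con 2 :* h) :+ (con 1 :+ i) := con 2 :* (con 2 :+ (h :+ i))) refl i h))
          (adjacent-colour (i + (3 + 2 * h)) j≤ (via i i≤ j≤))
        where
        j≤ : i + (3 + 2 * h) ≤ 7 + 2 * h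
        j≤ = linear 3 i≤
            (solve 2 (λ i h → i :+ (con 3 :+ con 2 :* h) :+ con 1 :+ con 3 := i :+ (con 7 :+ con 2 :* h)) refl i h)

    -- The path `x 2 ⋯ x (k - 1) ⟶ u ⟶ w ⟶ x 0` of length k forces the arc `x 2 ⟶ x 0`.
    absorbing-emitting : ∀ {u w} (outU : Outside u) (outW : Outside w) → u ⟶ w →
                         Both.Absorbing outU → Both.Emitting outW → SomeEvenBackArc
    absorbing-emitting {u} {w} outU outW r ab em = 0 , 0 , s≤s (s≤s z≤n) , back-arc
      (join (join (base {2} (2 + 2 * h) refl (slack 3
          (solve 1 (λ h → con 4 :+ (con 2 :* h :+ con 3) := con 7 :+ con 2 :* h) refl h))) (proj₁ (ab (4 + 2 * h) (slack 3
          (solve 1 (λ h → con 4 :+ (con 2 :* h :+ con 3) := con 7 :+ con 2 :* h) refl h)))) (join (point u) r (point w) λ { refl refl → irrefl _ r })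
          λ { (at l _ l≤ refl) (inj₁ e) → outU l (≤-trans l≤ (slack 3
              (solve 1 (λ h → con 4 :+ (con 2 :* h :+ con 3) := con 7 :+ con 2 :* h) refl h))) e
            ; (at l _ l≤ refl) (inj₂ e) → outW l (≤-trans l≤ (slack 3
                (solve 1 (λ h → con 4 :+ (con 2 :* h :+ con 3) := con 7 :+ con 2 :* h) refl h))) e })
        (proj₁ (em 0 z≤n)) (point (x 0))
        λ { (inj₁ (at l 2≤ l≤ refl)) e → inj 0 l (≤-trans (s≤s z≤n) 2≤) (≤-trans l≤ (slack 3
            (solve 1 (λ h → con 4 :+ (con 2 :* h :+ con 3) := con 7 :+ con 2 :* h) refl h))) (sym e)
          ; (inj₂ (inj₁ refl)) e → outU 0 z≤n (sym e)
          ; (inj₂ (inj₂ refl)) e → outW 0 z≤n (sym e) })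
      (solve 1 (λ h → con 2 :+ (con 2 :* h :+ con 2 :+ con 1) := con 5 :+ con 2 :* h) refl h) ≤-refl (s≤s (s≤s z≤n))

    -- The property of being dominated by P passes on to the next vertex of a path back to P, unless
    -- the two vertices already yield an even back arc, and the last one has an arc to P.
    absorbing-leads-to-even : ∀ {v n y} → Ray (flip _⟶_) P v n y → P v → (o : Outside y) → Both.Absorbing o → SomeEvenBackArc
    absorbing-leads-to-even {n = n} R (_ , l , l≤ , _ , refl) o₀ ab₀ = go n ≤-refl (subst Outside (sym last) o₀)
        (λ i i≤ → subst (λ z → x i ⟶ z × ¬ z ⟶ x i) (sym last) (ab₀ i i≤))
      where
      open Ray R
      go : ∀ j → j ≤ n → (o : Outside (w j)) → Both.Absorbing o → SomeEvenBackArc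
      go zero    _  o ab = contradiction first (proj₂ (ab l l≤))
      go (suc j) j< o ab with absorbing-successor o (outside (out j (<⇒≤ j<))) (link j j<) ab
      ... | t₀ , t₁ with Both.classify (outside (out j (<⇒≤ j<))) t₀ t₁
      ...   | inj₁ e          = e
      ...   | inj₂ (inj₁ ab′) = go j (<⇒≤ j<) (outside (out j (<⇒≤ j<))) ab′
      ...   | inj₂ (inj₂ em)  = absorbing-emitting o (outside (out j (<⇒≤ j<))) (link j j<) ab em

    -- The ray is followed backwards from `y`. Emission passes on to each predecessor, but `w 0`
    -- receives an arc from P and cannot emit.
    emitting-leads-to-even : ∀ {v n y} → Ray _⟶_ P v n y → P v → (o : Outside y) → Both.Emitting o → SomeEvenBackArc
    emitting-leads-to-even {n = n} R (_ , l , l≤ , _ , refl) o₀ em₀ = go n ≤-refl (subst Outside (sym last) o₀)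
        (λ i i≤ → subst (λ z → z ⟶ x i × ¬ x i ⟶ z) (sym last) (em₀ i i≤))
      where
      open Ray R
      go : ∀ j → j ≤ n → (o : Outside (w j)) → Both.Emitting o → SomeEvenBackArc
      go zero    _  o em = contradiction first (proj₂ (em l l≤))
      go (suc j) j< o em with emitting-predecessor (outside (out j (<⇒≤ j<))) o (link j j<) em
      ... | t₀ , t₁ with Both.classify (outside (out j (<⇒≤ j<))) t₀ t₁
      ...   | inj₁ e          = e
      ...   | inj₂ (inj₁ ab)  = absorbing-emitting (outside (out j (<⇒≤ j<))) o (link j j<) ab em
      ...   | inj₂ (inj₂ em′) = go j (<⇒≤ j<) (outside (out j (<⇒≤ j<))) em′

  abstract

    someEvenBackArc? : Dec SomeEvenBackArc
    someEvenBackArc? with anyUpTo? (λ i → anyUpTo? (λ d → 2 + 2 * d + i ≤? 7 + 2 * h ×-dec x (2 + 2 * d + i) ⟶? x i) (7 + 2 * h)) (7 + 2 * h)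
    ... | yes (i , _ , d , _ , e) = yes (i , d , e)
    ... | no none = no λ { (i , d , q≤ , r) → none (i , linear (1 + 2 * d) q≤
        (solve 3 (λ i d h → con 1 :+ (i :+ (con 7 :+ con 2 :* h) :+ (con 1 :+ con 2 :* d)) := con 2 :+ (con 2 :* d :+ i :+ (con 7 :+ con 2 :* h))) refl i d h)
                                               , d , linear (1 + d + i) q≤
                                                   (solve 3 (λ i d h → con 1 :+ (d :+ (con 7 :+ con 2 :* h) :+ (con 1 :+ (d :+ i))) := con 2 :+ (con 2 :* d :+ i :+ (con 7 :+ con 2 :* h))) refl i d h) , q≤ , r) }

    parity-suc-≢ : ∀ n → parity (suc n) ≢ parity n
    parity-suc-≢ zero    ()
    parity-suc-≢ (suc n) e = parity-suc-≢ n (sym e)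

    opposite-≢ : ∀ γ → 1ℙ ℙ.+ γ ≢ γ
    opposite-≢ 0ℙ ()
    opposite-≢ 1ℙ ()

    colour-suc : ∀ n β → parity (suc n) ℙ.+ β ≡ 1ℙ ℙ.+ (parity n ℙ.+ β)
    colour-suc n β = parity-shift (suc n) n 1 (suc n) β
        (solve 1 (λ n → con 1 :+ (n :+ (con 1 :+ n)) := con 2 :* (con 1 :+ n)) refl n)

    parity-between : ∀ j t → (∃ λ a → t ≡ 2 * a × parity (suc j + t) ≢ parity j) ⊎ (∃ λ a → t ≡ 1 + 2 * a × parity (suc j + t) ≡ parity j)
    parity-between j t with halve t
    ... | a , 0 , _ , refl , _ = inj₁ (a , +-identityʳ (2 * a) , λ e →
            parity-suc-≢ j (trans (sym (same-parity (suc j + (2 * a + 0)) (suc j) (suc j + a)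
                (solve 2 (λ j a → con 1 :+ (j :+ (con 2 :* a :+ con 0) :+ (con 1 :+ j)) := con 2 :* (con 1 :+ (j :+ a))) refl j a))) e))
    ... | a , 1 , _ , refl , _ = inj₂ (a , +-comm (2 * a) 1 , same-parity (suc j + (2 * a + 1)) j (1 + j + a)
        (solve 2 (λ j a → con 1 :+ (j :+ (con 2 :* a :+ con 1) :+ j) := con 2 :* (con 1 :+ (j :+ a))) refl j a))
    ... | a , suc (suc _) , _ , _ , ()

    same-parity-arc : ∀ {i j} → i ≤ 7 + 2 * h → j ≤ 7 + 2 * h → parity i ≡ parity j → x i ⟶ x j → SomeEvenBackArc
    same-parity-arc {i} {j} i≤ j≤ e r with <-cmp i j
    ... | tri≈ _ refl _ = contradiction r (irrefl _)
    ... | tri< i<j _ _ with m≤n⇒m<n∨m≡n i<j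
    ...   | inj₁ 2+i≤j = contradiction r (short 2+i≤j j≤)
    ...   | inj₂ refl  = contradiction (sym e) (parity-suc-≢ i)
    same-parity-arc {i} {j} i≤ j≤ e r | tri> _ _ j<i with remainder j<i
    ... | t , refl with parity-between j t
    ...   | inj₁ (_ , _ , differ)    = contradiction e differ
    ...   | inj₂ (a , refl , _) = j , a , subst (_≤ 7 + 2 * h) eq i≤ , subst (λ q → x q ⟶ x j) eq r
      where
      eq : suc j + (1 + 2 * a) ≡ 2 + 2 * a + j
      eq = solve 2 (λ j a → con 1 :+ (j :+ (con 1 :+ con 2 :* a)) := con 2 :+ (con 2 :* a :+ j)) refl j a

    ascending-adjacent : ∀ {i j} → j ≤ 7 + 2 * h → parity j ≢ parity i → i < j → Adj (x i) (x j)
    ascending-adjacent {i} j≤ differ i<j with remainder i<j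
    ... | t , refl with parity-between i t
    ...   | inj₂ (_ , _ , e)        = contradiction e differ
    ...   | inj₁ (zero , refl , _)  = inj₁ (subst (λ q → x i ⟶ x q) (sym (+-identityʳ (suc i)))
                                        (step i (subst (_≤ 7 + 2 * h) (+-identityʳ (suc i)) j≤)))
    ...   | inj₁ (suc a , refl , _) = inj₂ (back {suc i + 2 * suc a} i a
        (solve 2 (λ i a → con 1 :+ (i :+ con 2 :* (con 1 :+ a)) := con 3 :+ (con 2 :* a :+ i)) refl i a) j≤)

    opposite-parity-adjacent : ∀ {i j} → i ≤ 7 + 2 * h → j ≤ 7 + 2 * h → parity i ≢ parity j → Adj (x i) (x j)
    opposite-parity-adjacent {i} {j} i≤ j≤ differ with <-cmp i j
    ... | tri≈ _ refl _ = contradiction refl differ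
    ... | tri< i<j _ _  = ascending-adjacent j≤ (differ ∘ sym) i<j
    ... | tri> _ _ j<i  = swap (ascending-adjacent i≤ differ j<i)

    complete-adjacent : BackwardComplete → ∀ {i j} → i ≤ 7 + 2 * h → j ≤ 7 + 2 * h → i ≢ j → Adj (x i) (x j)
    complete-adjacent full {i} {j} i≤ j≤ i≢j with <-cmp i j
    ... | tri≈ _ e _ = contradiction e i≢j
    ... | tri< i<j _ _ with m≤n⇒m<n∨m≡n i<j
    ...   | inj₁ 2+i≤j = inj₂ (full 2+i≤j j≤)
    ...   | inj₂ refl  = inj₁ (step i j≤)
    complete-adjacent full {i} {j} i≤ j≤ i≢j | tri> _ _ j<i with m≤n⇒m<n∨m≡n j<i
    ... | inj₁ 2+j≤i = inj₁ (full 2+j≤i i≤)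
    ... | inj₂ refl  = inj₂ (step j i≤)

  -- Lets a ray start again behind a vertex that has to be avoided.
  dropRay : ∀ {v n y u} (R : Ray _⟶_ P v n y) i t → i + t ≡ n → u ⟶ Ray.w R i → Ray _⟶_ P u t y
  dropRay {u = u} R i t e r = record
    { w = λ j → w (i + j) ; first = subst (λ j → u ⟶ w j) (sym (+-identityʳ i)) r
    ; link = λ j j<t → subst (λ l → w (i + j) ⟶ w l) (sym (+-suc i j)) (link (i + j) (<-≤-trans (+-monoʳ-< i j<t) (≤-reflexive e)))
    ; simple = λ j l j<l l≤t → simple (i + j) (i + l) (+-monoʳ-< i j<l) (≤-trans (+-monoʳ-≤ i l≤t) (≤-reflexive e))
    ; out = λ j j≤t → out (i + j) (≤-trans (+-monoʳ-≤ i j≤t) (≤-reflexive e)) ; last = trans (cong w e) last }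
    where open Ray R

  -- The digraph outside P in the two cases

  module Conclusion
    (rayTo   : ∀ {y} → ¬ P y → ∃ λ v → ∃ λ n → P v × Ray _⟶_ P v n y)
    (rayFrom : ∀ {y} → ¬ P y → ∃ λ v → ∃ λ n → P v × Ray (flip _⟶_) P v n y)
    where

    abstract

      coloured : ∀ {y} → ¬ P y → ∃ λ γ → E.AdjC γ y
      coloured y∉P with rayTo y∉P
      ... | _ , n , (β , c) , R = parity n ℙ.+ β , E.adjacent-to-P R c

    module Bipartite (noEven : ¬ SomeEvenBackArc) where

      abstract

        -- A vertex dominated by P still has a path back to P, and one that dominates P is still
        -- reached from P. Along such a path the property has to break down, which costs an even
        -- back arc.
        exclusive : ∀ {y} → ¬ P y → E.AdjC 0ℙ y → E.AdjC 1ℙ y → ⊥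
        exclusive y∉P a₀ a₁ with Both.classify (outside y∉P) (touches-0 (outside y∉P) a₀) (touches-1 (outside y∉P) a₁)
        ... | inj₁ e = noEven e
        ... | inj₂ (inj₁ ab) with rayFrom y∉P
        ...   | _ , _ , v∈ , R = noEven (absorbing-leads-to-even R v∈ (outside y∉P) ab)
        exclusive y∉P a₀ a₁ | inj₂ (inj₂ em) with rayTo y∉P
        ... | _ , _ , v∈ , R = noEven (emitting-leads-to-even R v∈ (outside y∉P) em)

        unique-colour : ∀ {y β γ} → ¬ P y → E.AdjC β y → E.AdjC γ y → β ≡ γ
        unique-colour {β = 0ℙ} {0ℙ} _   _ _ = refl
        unique-colour {β = 1ℙ} {1ℙ} _   _ _ = refl
        unique-colour {β = 0ℙ} {1ℙ} y∉P a b = ⊥-elim (exclusive y∉P a b)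
        unique-colour {β = 1ℙ} {0ℙ} y∉P a b = ⊥-elim (exclusive y∉P b a)

        -- Extending the ray by the arc would give `z` the colour opposite to that of `y`.
        no-arc-avoiding : ∀ {v n y z γ β} (R : Ray _⟶_ P v n y) → C β v → ¬ P y → ¬ P z → E.AdjC γ y → E.AdjC γ z →
                          (∀ i → i ≤ n → Ray.w R i ≢ z) → ¬ y ⟶ z
        no-arc-avoiding {n = n} {β = β} R c y∉P z∉P a b fresh r = opposite-≢ (parity n ℙ.+ β)
          (trans (sym (colour-suc n β)) (trans (unique-colour z∉P (E.adjacent-to-P (E.extend R r z∉P fresh) c) b)
            (unique-colour y∉P a (E.adjacent-to-P R c))))

        -- If z lies on the ray to y, its successor w on the ray is adjacent to P: either w gives
        -- a ray to y that avoids z, or y ⟶ z ⟶ w ⟶ u contradicts the colours of y and z.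
        no-arc : ∀ {y z γ} → ¬ P y → ¬ P z → E.AdjC γ y → E.AdjC γ z → ¬ y ⟶ z
        no-arc {y} {z} {γ} y∉P z∉P a b r with rayTo y∉P
        ... | v , n , (β , c) , R with anyUpTo? (λ j → Ray.w R j ≟ z) (suc n)
        ...   | no none = no-arc-avoiding R c y∉P z∉P a b (λ i i≤ e → none (i , s≤s i≤ , e)) r
        ...   | yes (j , s≤s j≤n , refl) with m≤n⇒m<n∨m≡n j≤n
        ...     | inj₂ refl = irrefl _ (subst (_⟶ Ray.w R j) (sym (Ray.last R)) r)
        ...     | inj₁ j<n with E.adjacent-to-P (E.truncate R (suc j) j<n) c | remainder j<n
        ...       | u , cu , inj₁ u⟶w | t , e =
                      no-arc-avoiding (dropRay R (suc j) t e u⟶w) cu y∉P z∉P a b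
                        (λ i i≤ e′ → Ray.simple R j (suc j + i) (s≤s (m≤m+n j i)) (≤-trans (+-monoʳ-≤ (suc j) i≤) (≤-reflexive e)) (sym e′)) r
        -- Here `z` directly precedes `y` on the ray, and the neighbour `u` of `y` shows that their
        -- colours are opposite.
        ...       | u , cu , inj₂ w⟶u | zero , e = opposite-≢ (parity j ℙ.+ β)
                      (trans (sym (colour-suc j β)) (trans (unique-colour y∉P (subst (E.AdjC _) at-end (u , cu , inj₂ w⟶u)) a)
                        (unique-colour z∉P b (E.adjacent-to-P (E.truncate R j j≤n) c))))
          where
          at-end : Ray.w R (suc j) ≡ y
          at-end = trans (cong (Ray.w R) (trans (sym (+-identityʳ (suc j))) e)) (Ray.last R)
        -- The paths of length k that start at `z` and at `y` have k - 2 and k - 3 arcs inside P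
        -- after `u`. Their ends therefore have opposite colours, although `y` and `z` share one.
        ...       | u , cu , inj₂ w⟶u | suc t , e with from (2 + 2 * h) (m≤n+m (2 + 2 * h) 2) cu | from (3 + 2 * h) (n≤1+n _) cu
        ...         | u₁ , c₁ , p₁ | u₂ , c₂ , p₂ = opposite-≢ _
                      (trans (sym (colour-suc (2 + 2 * h) _))
                        (trans (unique-colour z∉P (u₂ , c₂ , swap (adj p-z)) b) (unique-colour y∉P a (u₁ , c₁ , swap (adj p-y)))))
          where
          open Ray R using (w; link; simple; out; last)
          j+1<n : suc j < n
          j+1<n = linear t (≤-reflexive e)
              (solve 3 (λ j t n → con 2 :+ (j :+ n :+ t) := con 1 :+ (j :+ (con 1 :+ t) :+ n)) refl j t n)
          p-z : SPath (w j) u₂ (5 + 2 * h) ((_≡ w j) ∪ ((_≡ w (suc j)) ∪ P))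
          p-z = join (point (w j)) (link j j<n) (join (point (w (suc j))) w⟶u p₂ λ { refl q → out (suc j) j<n q })
                  λ { refl (inj₁ e′) → simple j (suc j) ≤-refl j<n e′ ; refl (inj₂ q) → z∉P q }
          p-y : SPath y u₁ (5 + 2 * h) ((_≡ y) ∪ ((_≡ w j) ∪ ((_≡ w (suc j)) ∪ P)))
          p-y = join (point y) r (join (point (w j)) (link j j<n) (join (point (w (suc j))) w⟶u p₁ λ { refl q → out (suc j) j<n q })
                  λ { refl (inj₁ e′) → simple j (suc j) ≤-refl j<n e′ ; refl (inj₂ q) → z∉P q })
                  λ { refl (inj₁ e′) → irrefl _ (subst (_⟶ w j) e′ r)
                    ; refl (inj₂ (inj₁ e′)) → simple (suc j) n j+1<n ≤-refl (sym (trans last e′))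
                    ; refl (inj₂ (inj₂ q)) → y∉P q }

        -- In the one-sided cases the connection comes from a ray: in the given digraph if both
        -- vertices dominate their classes, in the reversed one if both are dominated.
        -- `unique-colour` identifies the class that `Exited` speaks of.
        across : ∀ {y z} → ¬ P y → ¬ P z → y ≢ z → E.AdjC 0ℙ y → E.AdjC 1ℙ z → Adj y z
        across {y} {z} y∉P z∉P y≢z a b = conclude (adjacent-or-one-sided (touches-0 (outside y∉P) a) (touches-1 (outside z∉P) b))
          where
          open Cross (outside y∉P) (outside z∉P) y≢z
          conclude : Adj y z ⊎ (Y.NoIn × Z.NoIn) ⊎ (Y.NoOut × Z.NoOut) → Adj y z
          conclude (inj₁ r) = r
          conclude (inj₂ (inj₁ (ny , nz))) with rayTo y∉P
          ... | _ , _ , (_ , c) , R = E.dominating-adjacent R c y≢z y∉P z∉P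
              (λ {_} {n} {β} R c → subst (λ γ → E.Dominates γ z)
                 (trans (cong (1ℙ ℙ.+_) (unique-colour y∉P a (E.adjacent-to-P R c))) (sym (colour-suc n β))) dom-z)
              (λ {_} {n} {β} R c → subst (λ γ → E.Dominates γ y)
                 (trans (cong (1ℙ ℙ.+_) (unique-colour z∉P b (E.adjacent-to-P R c))) (sym (colour-suc n β))) dom-y)
            where
            dom-z : E.Dominates 1ℙ z
            dom-z _ (l , l≤ , e , refl) with odd-index l l≤ e
            ... | s , s≤ , refl = Z.all-out nz (touches-1 (outside z∉P) b) s s≤
            dom-y : E.Dominates 0ℙ y
            dom-y _ (l , l≤ , e , refl) with even-index l l≤ e
            ... | s , s≤ , refl = Y.all-out ny (touches-0 (outside y∉P) a) s s≤
          conclude (inj₂ (inj₂ (ny , nz))) with rayFrom y∉P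
          ... | _ , _ , (_ , c) , R = swap (E′.dominating-adjacent R c y≢z y∉P z∉P
              (λ {_} {n} {β} R c → subst (λ γ → E′.Dominates γ z)
                 (trans (cong (1ℙ ℙ.+_) (unique-colour y∉P a (unflip (E′.adjacent-to-P R c)))) (sym (colour-suc n β))) dom-z)
              (λ {_} {n} {β} R c → subst (λ γ → E′.Dominates γ y)
                 (trans (cong (1ℙ ℙ.+_) (unique-colour z∉P b (unflip (E′.adjacent-to-P R c)))) (sym (colour-suc n β))) dom-y))
            where
            unflip : ∀ {γ u} → E′.AdjC γ u → E.AdjC γ u
            unflip (v , c , r) = v , c , swap r
            dom-z : E′.Dominates 1ℙ z
            dom-z _ (l , l≤ , e , refl) with odd-index l l≤ e
            ... | s , s≤ , refl = Z.all-in nz (touches-1 (outside z∉P) b) s s≤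
            dom-y : E′.Dominates 0ℙ y
            dom-y _ (l , l≤ , e , refl) with even-index l l≤ e
            ... | s , s≤ , refl = Y.all-in ny (touches-0 (outside y∉P) a) s s≤

    module Full (full : BackwardComplete) where

      abstract

        -- The even back arcs `x (k - 1) ⟶ x 0` and `x (k + 2) ⟶ x 3` break parity: with arcs of odd
        -- gap alone, k - 1 arcs would lead to an index of the same parity.
        down-step : ∀ p → p ≤ 6 + 2 * h → SPath (x (suc p)) (x p) (4 + 2 * h) OnP
        down-step p p≤ with p ≤? 3 + 2 * h
        ... | yes p≤′ with remainder p≤′
        ...   | r , e = sized (onP (block {suc p} {4 + 2 * h} r (full {0} {4 + 2 * h} (s≤s (s≤s z≤n)) (slack 3
            (solve 1 (λ h → con 4 :+ (con 2 :* h :+ con 3) := con 7 :+ con 2 :* h) refl h))) (cong suc e) (slack 3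
            (solve 1 (λ h → con 4 :+ (con 2 :* h :+ con 3) := con 7 :+ con 2 :* h) refl h))
                          (base {0} p refl (m≤n⇒m≤1+n p≤)) ≤-refl z≤n) (slack 3
                              (solve 1 (λ h → con 4 :+ (con 2 :* h :+ con 3) := con 7 :+ con 2 :* h) refl h)))
                          (balance e
                              (solve 3 (λ r p h → r :+ (con 1 :+ p) :+ (con 3 :+ con 2 :* h) := p :+ r :+ (con 4 :+ con 2 :* h)) refl r p h))
        down-step p p≤ | no p≰ with remainder {3} (≤-trans (m≤m+n 3 (1 + 2 * h)) (≰⇒> p≰)) | remainder p≤
        ... | s , refl | r , e = sized (onP (block {4 + s} {7 + 2 * h} r (full {3} {7 + 2 * h} (m≤m+n 5 (2 + 2 * h)) ≤-refl) (cong suc e) ≤-refl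
                          (base {3} s refl (m≤n⇒m≤1+n p≤)) ≤-refl (m≤m+n 3 (1 + s))) ≤-refl)
                          (balance e
                              (solve 3 (λ r s h → r :+ (con 1 :+ s) :+ (con 6 :+ con 2 :* h) := con 3 :+ (s :+ r :+ (con 4 :+ con 2 :* h))) refl r s h))

        -- `down-step` carries an arc to `y` up by one index and an arc from `y` down by one. At the
        -- end of P where that is impossible, the adjacency is first moved into the interior along
        -- an ascending path of length k - 1.
        consecutive : ∀ {y l} → Outside y → l ≤ 7 + 2 * h → Adj (x l) y →
                      ∃ λ i → suc i ≤ 7 + 2 * h × Adj (x i) y × Adj (x (suc i)) y
        consecutive {l = l} o l≤ (inj₁ r) with m≤n⇒m<n∨m≡n l≤
        ... | inj₁ l<N  = l , l<N , inj₁ r , adj-in o (down-step l (s≤s⁻¹ l<N)) r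
        ... | inj₂ refl with adj-in o (up 3 (4 + 2 * h) {7 + 2 * h} refl ≤-refl) r
        ...   | inj₁ r₃ = 3 , m≤m+n 4 (3 + 2 * h) , inj₁ r₃ , adj-in o (down-step 3 (m≤m+n 3 (3 + 2 * h))) r₃
        ...   | inj₂ r₃ = 2 , m≤m+n 3 (4 + 2 * h) , adj-out o (down-step 2 (m≤m+n 2 (4 + 2 * h))) r₃ , inj₂ r₃
        consecutive {l = suc l} o l≤ (inj₂ r) = l , l≤ , adj-out o (down-step l (s≤s⁻¹ l≤)) r , inj₂ r
        consecutive {l = zero}  o l≤ (inj₂ r) with adj-out o (up 0 (4 + 2 * h) {4 + 2 * h} refl (slack 3
            (solve 1 (λ h → con 4 :+ (con 2 :* h :+ con 3) := con 7 :+ con 2 :* h) refl h))) r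
        ... | inj₁ r₄ = 4 + 2 * h , slack 2
            (solve 1 (λ h → con 5 :+ (con 2 :* h :+ con 2) := con 7 :+ con 2 :* h) refl h) , inj₁ r₄ , adj-in o (down-step (4 + 2 * h) (slack 2
            (solve 1 (λ h → con 4 :+ (con 2 :* h :+ con 2) := con 6 :+ con 2 :* h) refl h))) r₄
        ... | inj₂ r₄ = 3 + 2 * h , slack 3
            (solve 1 (λ h → con 4 :+ (con 2 :* h :+ con 3) := con 7 :+ con 2 :* h) refl h) , adj-out o (down-step (3 + 2 * h) (slack 3
            (solve 1 (λ h → con 3 :+ (con 2 :* h :+ con 3) := con 6 :+ con 2 :* h) refl h))) r₄ , inj₂ r₄

        both-touched : ∀ {y} (y∉P : ¬ P y) → BothTouched (outside y∉P)
        both-touched y∉P with coloured y∉P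
        ... | _ , _ , (l , l≤ , _ , refl) , a with consecutive (outside y∉P) l≤ a
        ...   | i , i< , a₀ , a₁ with parity i in e
        ...     | 0ℙ = touches-0 (outside y∉P) (_ , (i , <⇒≤ i< , e , refl) , a₀)
                     , touches-1 (outside y∉P) (_ , (suc i , i< , trans (+-homo-+ 1 i) (cong (1ℙ ℙ.+_) e) , refl) , a₁)
        ...     | 1ℙ = touches-0 (outside y∉P) (_ , (suc i , i< , trans (+-homo-+ 1 i) (cong (1ℙ ℙ.+_) e) , refl) , a₁)
                     , touches-1 (outside y∉P) (_ , (i , <⇒≤ i< , e , refl) , a₀)

        -- Each vertex touches both parities, so `Cross` applies with both assignments of parities.
        -- If neither yields an adjacency, the missing directions combine to two emitting vertices,
        -- two absorbing ones, or a contradiction.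
        outside-adjacent : ∀ {y z} → ¬ P y → ¬ P z → y ≢ z → Adj y z
        outside-adjacent {y} {z} y∉P z∉P y≢z = conclude
            (YZ.adjacent-or-one-sided (proj₁ ty) (proj₂ tz)) (ZY.adjacent-or-one-sided (proj₁ tz) (proj₂ ty))
          where
          module YZ = Cross (outside y∉P) (outside z∉P) y≢z
          module ZY = Cross (outside z∉P) (outside y∉P) (y≢z ∘ sym)
          ty : BothTouched (outside y∉P)
          ty = both-touched y∉P
          tz : BothTouched (outside z∉P)
          tz = both-touched z∉P
          conclude : Adj y z ⊎ (YZ.Y.NoIn × YZ.Z.NoIn) ⊎ (YZ.Y.NoOut × YZ.Z.NoOut) →
                     Adj z y ⊎ (ZY.Y.NoIn × ZY.Z.NoIn) ⊎ (ZY.Y.NoOut × ZY.Z.NoOut) → Adj y z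
          conclude (inj₁ r) _ = r
          conclude _ (inj₁ r) = swap r
          conclude (inj₂ (inj₁ (y₀ , z₁))) (inj₂ (inj₁ (z₀ , y₁))) with rayTo y∉P
          ... | _ , _ , (_ , c) , R = E.dominating-adjacent R c y≢z y∉P z∉P
              (λ _ _ → λ { _ (l , l≤ , _ , refl) → proj₁ (Both.emitting (outside z∉P) z₀ z₁ (proj₁ tz) (proj₂ tz) l l≤) })
              (λ _ _ → λ { _ (l , l≤ , _ , refl) → proj₁ (Both.emitting (outside y∉P) y₀ y₁ (proj₁ ty) (proj₂ ty) l l≤) })
          conclude (inj₂ (inj₂ (y₀ , z₁))) (inj₂ (inj₂ (z₀ , y₁))) with rayFrom y∉P
          ... | _ , _ , (_ , c) , R = swap (E′.dominating-adjacent R c y≢z y∉P z∉P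
              (λ _ _ → λ { _ (l , l≤ , _ , refl) → proj₁ (Both.absorbing (outside z∉P) z₀ z₁ (proj₁ tz) (proj₂ tz) l l≤) })
              (λ _ _ → λ { _ (l , l≤ , _ , refl) → proj₁ (Both.absorbing (outside y∉P) y₀ y₁ (proj₁ ty) (proj₂ ty) l l≤) }))
          -- `x 1 ⟶ y ⟶ x (k + 1)` would be a shortcut; in the other mixed case it is
          -- `x 0 ⟶ y ⟶ x (k + 2)`.
          conclude (inj₂ (inj₁ (y₀ , _))) (inj₂ (inj₂ (_ , y₁))) =
            contradiction (YZ.Y.all-out y₀ (proj₁ ty) (3 + h) ≤-refl)
              (short₂ {1} {2 * (3 + h)} (slack (2 + 2 * h)
                  (solve 1 (λ h → con 6 :+ con 2 :* h := con 2 :* (con 3 :+ h)) refl h)) (YZ.Y.index≤ (3 + h) ≤-refl) (outside y∉P) (ZY.Z.all-in y₁ (proj₂ ty) 0 z≤n))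
          conclude (inj₂ (inj₂ (y₀ , _))) (inj₂ (inj₁ (_ , y₁))) =
            contradiction (ZY.Z.all-out y₁ (proj₂ ty) (3 + h) ≤-refl)
              (short₂ {0} {1 + 2 * (3 + h)} (slack (4 + 2 * h)
                  (solve 1 (λ h → con 7 :+ con 2 :* h := con 1 :+ con 2 :* (con 3 :+ h)) refl h)) (ZY.Z.index≤ (3 + h) ≤-refl) (outside y∉P) (YZ.Y.all-in y₀ (proj₁ ty) 0 z≤n))

-- From paths of the digraph to rays

module _ {V : Set} {_⟶_ : Rel V 0ℓ} {P : Pred V 0ℓ} where

  abstract

    -- The last visit to P is sought downwards from `L`; what follows it is a ray.
    lastExit : (∀ v → Dec (P v)) → ∀ (f : ℕ → V) L → P (f 0) → ¬ P (f L) →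
               (∀ j → j < L → f j ⟶ f (suc j)) → (∀ i j → i < j → j ≤ L → f i ≢ f j) →
               ∃ λ v → ∃ λ n → P v × Ray _⟶_ P v n (f L)
    lastExit P? f L start∈ end∉ arcs simple = descend L ≤-refl λ j L<j j≤L → contradiction j≤L (<⇒≱ L<j)
      where
      descend : ∀ t → t ≤ L → (∀ j → t < j → j ≤ L → ¬ P (f j)) → ∃ λ v → ∃ λ n → P v × Ray _⟶_ P v n (f L)
      descend t t≤L beyond with P? (f t)
      ... | yes ft∈ with m≤n⇒m<n∨m≡n t≤L
      ...   | inj₂ refl = contradiction ft∈ end∉
      ...   | inj₁ t<L with remainder t<L
      ...     | n , refl = f t , n , ft∈ , record
        { w      = λ j → f (suc t + j)
        ; first  = subst (λ j → f t ⟶ f j) (sym (+-identityʳ (suc t))) (arcs t t<L)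
        ; link   = λ j j<n → subst (λ l → f (suc t + j) ⟶ f l) (sym (+-suc (suc t) j)) (arcs (suc t + j) (+-monoʳ-< (suc t) j<n))
        ; simple = λ i j i<j j≤n → simple (suc t + i) (suc t + j) (+-monoʳ-< (suc t) i<j) (+-monoʳ-≤ (suc t) j≤n)
        ; out    = λ j j≤n → beyond (suc t + j) (s≤s (m≤m+n t j)) (+-monoʳ-≤ (suc t) j≤n)
        ; last   = refl }
      descend zero    t≤L beyond | no f0∉ = contradiction start∈ f0∉
      descend (suc t) t≤L beyond | no ft∉ = descend t (<⇒≤ t≤L) λ j t<j j≤L → case-split j t<j j≤L
        where
        case-split : ∀ j → t < j → j ≤ L → ¬ P (f j)
        case-split j t<j j≤L with m≤n⇒m<n∨m≡n t<j
        ... | inj₁ t+1<j = beyond j t+1<j j≤L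
        ... | inj₂ refl  = ft∉

-- Beyond its length a path is continued by its last vertex.
module Sequence {V : Set} {D : Digraph V} {a b : V} (Q : Path D a b) where

  place : ℕ → Fin (suc (length Q))
  place i = fromℕ< {i ⊓ length Q} (s≤s (m⊓n≤n i (length Q)))

  seq : ℕ → V
  seq i = vertex Q (place i)

  abstract

    toℕ-place : ∀ {i} → i ≤ length Q → toℕ (place i) ≡ i
    toℕ-place i≤ = trans (toℕ-fromℕ< _) (m≤n⇒m⊓n≡m i≤)

    place-toℕ : ∀ i → place (toℕ i) ≡ i
    place-toℕ i = toℕ-injective (toℕ-place (toℕ≤pred[n] i))

    seq-start : seq 0 ≡ a
    seq-start = Path.start Q

    seq-end : seq (length Q) ≡ b
    seq-end = trans (cong (vertex Q) (toℕ-injective (trans (toℕ-place ≤-refl) (sym (toℕ-fromℕ (length Q)))))) (Path.end Q)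

    seq-arcs : ∀ i → i < length Q → Arc D (seq i) (seq (suc i))
    seq-arcs i i< = subst₂ (λ p q → Arc D (vertex Q p) (vertex Q q))
      (toℕ-injective (trans (toℕ-inject₁ _) (trans (toℕ-fromℕ< i<) (sym (toℕ-place (<⇒≤ i<))))))
      (toℕ-injective (trans (cong suc (toℕ-fromℕ< i<)) (sym (toℕ-place i<))))
      (arcs Q (fromℕ< i<))

    seq-simple : ∀ i j → i < j → j ≤ length Q → seq i ≢ seq j
    seq-simple i j i<j j≤ e = <⇒≢ i<j (trans (sym (toℕ-place (≤-trans (<⇒≤ i<j) j≤))) (trans (cong toℕ (distinct Q e)) (toℕ-place j≤)))

abstract

  ∈-⋃-tabulate⁻ : ∀ {n m x} (f : Fin m → Subset n) → x ∈ₛ ⋃ (List.tabulate f) → ∃ λ i → x ∈ₛ f i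
  ∈-⋃-tabulate⁻ {m = zero}  f x∈ = contradiction x∈ ∉⊥
  ∈-⋃-tabulate⁻ {m = suc m} f x∈ with x∈p∪q⁻ (f Fin.zero) _ x∈
  ... | inj₁ x∈f = Fin.zero , x∈f
  ... | inj₂ x∈⋃ with ∈-⋃-tabulate⁻ (f ∘ Fin.suc) x∈⋃
  ...   | i , x∈f = Fin.suc i , x∈f

  ∈-⋃-tabulate⁺ : ∀ {n m x} (f : Fin m → Subset n) i → x ∈ₛ f i → x ∈ₛ ⋃ (List.tabulate f)
  ∈-⋃-tabulate⁺ f Fin.zero    x∈ = p⊆p∪q _ x∈
  ∈-⋃-tabulate⁺ f (Fin.suc i) x∈ = q⊆p∪q (f Fin.zero) _ (∈-⋃-tabulate⁺ (f ∘ Fin.suc) i x∈)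

  odd≥5 : ∀ k → k % 2 ≡ 1 → 5 ≤ k → ∃ λ h → k ≡ 5 + 2 * h
  odd≥5 k odd 5≤k with remainder 5≤k
  ... | r , refl with halve r
  ...   | a , 0 , _ , refl , _ = a , cong (5 +_) (+-identityʳ (2 * a))
  ...   | a , 1 , _ , refl , _ = contradiction (trans (sym odd) (trans (cong (_% 2) ((5 + (2 * a + 1) ≡ 6 + a * 2) ∋ solve 1 (λ a → con 5 :+ (con 2 :* a :+ con 1) := con 6 :+ a :* con 2) refl a)) ([m+kn]%n≡m%n 6 a 2))) λ ()
  odd≥5 k odd 5≤k | r , refl | a , suc (suc _) , _ , _ , ()

-- Assembly for a shortest path of length k + 2

module Main {n : ℕ} (h : ℕ) (D : Digraph (Fin n)) (strong : Strong D) (qt : QuasiTransitive (5 + 2 * h) D)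
  {u v : Fin n} (Q : Path D u v) (length≡ : length Q ≡ 7 + 2 * h) (shortest : Shortest Q) where

  open Trails (Arc D) using (SPath; Between; at; point; join; segment)
  open Sequence Q

  x : ℕ → Fin n
  x = seq

  abstract

    step : ∀ i → i < 7 + 2 * h → Arc D (x i) (x (suc i))
    step i i< = seq-arcs i (subst (i <_) (sym length≡) i<)

    inj : ∀ i j → i < j → j ≤ 7 + 2 * h → x i ≢ x j
    inj i j i<j j≤ = seq-simple i j i<j (subst (j ≤_) (sym length≡) j≤)

    adj : ∀ {a b M} → SPath a b (5 + 2 * h) M → Adjacent D a b
    adj {a} {b} p with toPath D p
    ... | R , e = qt a b R e

    part : ∀ i r → i + r ≤ 7 + 2 * h → SPath (x i) (x (i + r)) r (Between x i (i + r))
    part i r ≤N = segment x i r (λ l _ l< → step l (<-≤-trans l< ≤N)) (λ l m _ l<m m≤ → inj l m l<m (≤-trans m≤ ≤N))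

    no-shortcut : ∀ {ℓ M} → SPath (x 0) (x (7 + 2 * h)) ℓ M → 7 + 2 * h ≤ ℓ
    no-shortcut {ℓ} {M} p with toPath D (subst₂ (λ a b → SPath a b ℓ M) seq-start (trans (cong x (sym length≡)) seq-end) p)
    ... | R , e = subst₂ _≤_ length≡ e (shortest R)

    short : ∀ {i j} → 2 + i ≤ j → j ≤ 7 + 2 * h → ¬ Arc D (x i) (x j)
    short {i} {j} i≪j j≤ r with remainder j≤
    ... | t , e = <⇒≱ ((i + suc t < 7 + 2 * h) ∋ linear 0 (+-mono-≤ i≪j (≤-reflexive e))
        (solve 4 (λ i j t h → con 1 :+ (i :+ (con 1 :+ t) :+ (j :+ (con 7 :+ con 2 :* h)) :+ con 0) := con 2 :+ (i :+ (j :+ t) :+ (con 7 :+ con 2 :* h))) refl i j t h))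
        (no-shortcut (subst (λ m → SPath (x 0) (x m) (i + suc t) (Between x 0 i ∪ Between x j (j + t))) e
          (join (part 0 i (≤-trans (≤-trans (m≤n+m i 2) i≪j) j≤)) r (part j t (≤-reflexive e))
            λ { (at l _ l≤ refl) (at m j≤m m≤ e′) → inj l m (≤-<-trans l≤ (<-≤-trans (<⇒≤ i≪j) j≤m)) (≤-trans m≤ (≤-reflexive e)) e′ })))

    short₂ : ∀ {i j y} → 3 + i ≤ j → j ≤ 7 + 2 * h → (∀ l → l ≤ 7 + 2 * h → x l ≢ y) → Arc D (x i) y → ¬ Arc D y (x j)
    short₂ {i} {j} {y} i≪j j≤ out r r′ with remainder j≤
    ... | t , e = <⇒≱ ((i + suc (suc t) < 7 + 2 * h) ∋ linear 0 (+-mono-≤ i≪j (≤-reflexive e))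
        (solve 4 (λ i j t h → con 1 :+ (i :+ (con 2 :+ t) :+ (j :+ (con 7 :+ con 2 :* h)) :+ con 0) := con 3 :+ (i :+ (j :+ t) :+ (con 7 :+ con 2 :* h))) refl i j t h))
        (no-shortcut (subst (λ m → SPath (x 0) (x m) (i + suc (suc t)) (Between x 0 i ∪ ((_≡ y) ∪ Between x j (j + t)))) e
          (join (part 0 i i≤) r (join (point y) r′ (part j t (≤-reflexive e))
              λ { refl (at m _ m≤ e′) → out m (≤-trans m≤ (≤-reflexive e)) (sym e′) })
            λ { (at l _ l≤ refl) (inj₁ e′) → out l (≤-trans l≤ i≤) e′
              ; (at l _ l≤ refl) (inj₂ (at m j≤m m≤ e′)) →
                  inj l m (≤-<-trans l≤ (<-≤-trans (<⇒≤ (<⇒≤ i≪j)) j≤m)) (≤-trans m≤ (≤-reflexive e)) e′ })))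
      where
      i≤ : i ≤ 7 + 2 * h
      i≤ = ≤-trans (≤-trans (m≤n+m i 3) i≪j) j≤

  open Geodesic (Arc D) h x step inj adj short short₂ (arc? D) Fin._≟_ (noLoop D)

  abstract

    P? : ∀ w → Dec (P w)
    P? w with anyUpTo? (λ l → w Fin.≟ x l) (8 + 2 * h)
    ... | yes (l , l< , e) = yes (parity l , l , s≤s⁻¹ l< , refl , e)
    ... | no none          = no λ (_ , l , l≤ , _ , e) → none (l , s≤s l≤ , e)

    u∈P : P u
    u∈P = 0ℙ , 0 , z≤n , refl , sym seq-start

    rayTo : ∀ {y} → ¬ P y → ∃ λ w → ∃ λ m → P w × Ray (Arc D) P w m y
    rayTo {y} y∉P = subst (λ z → ∃ λ w → ∃ λ m → P w × Ray (Arc D) P w m z) R.seq-end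
        (lastExit P? R.seq _ (subst P (sym R.seq-start) u∈P) (y∉P ∘ subst P R.seq-end) R.seq-arcs R.seq-simple)
      where module R = Sequence (strong u y)

    rayFrom : ∀ {y} → ¬ P y → ∃ λ w → ∃ λ m → P w × Ray (flip (Arc D)) P w m y
    rayFrom {y} y∉P = subst (λ z → ∃ λ w → ∃ λ m → P w × Ray (flip (Arc D)) P w m z) back-end
        (lastExit P? back-seq L (subst P (sym R.seq-end) u∈P) (y∉P ∘ subst P back-end) back-arcs back-simple)
      where
      module R = Sequence (strong y u)
      L : ℕ
      L = length (strong y u)
      back-seq : ℕ → Fin n
      back-seq j = R.seq (L ∸ j)
      back-end : back-seq L ≡ y
      back-end = trans (cong R.seq (n∸n≡0 L)) R.seq-start
      suc-∸ : ∀ {j} → j < L → suc (L ∸ suc j) ≡ L ∸ j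
      suc-∸ j< = sym (+-∸-assoc 1 j<)
      back-arcs : ∀ j → j < L → Arc D (back-seq (suc j)) (back-seq j)
      back-arcs j j< = subst (λ l → Arc D (back-seq (suc j)) (R.seq l)) (suc-∸ j<)
        (R.seq-arcs (L ∸ suc j) (subst (_≤ L) (sym (suc-∸ j<)) (m∸n≤m L j)))
      back-simple : ∀ i j → i < j → j ≤ L → back-seq i ≢ back-seq j
      back-simple i j i<j j≤ e = R.seq-simple (L ∸ j) (L ∸ i) (∸-monoʳ-< i<j j≤) (m∸n≤m L i) (sym e)

  open Conclusion rayTo rayFrom

  abstract

    on-path : ∀ {z} → z ∈ₛ vertices Q → P z
    on-path z∈ with ∈-⋃-tabulate⁻ (⁅_⁆ ∘ vertex Q) z∈
    ... | i , z∈i = _ , toℕ i , subst (toℕ i ≤_) length≡ (toℕ≤pred[n] i) , refl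
                  , trans (x∈⁅y⁆⇒x≡y _ z∈i) (cong (vertex Q) (sym (place-toℕ i)))

    off-path : ∀ {z} → z ∈ₛ ∁ (vertices Q) → ¬ P z
    off-path z∈ (_ , l , _ , _ , refl) = x∈∁p⇒x∉p z∈ (∈-⋃-tabulate⁺ (⁅_⁆ ∘ vertex Q) (place l) (x∈⁅x⁆ (x l)))

    proj₁-≢ : ∀ {S : Subset n} {a b : ∃ λ z → z ∈ₛ S} → a ≢ b → proj₁ a ≢ proj₁ b
    proj₁-≢ {a = a , p} {_ , q} a≢b refl = a≢b (cong (a ,_) ([]=-irrelevant p q))

    conclusion :
      (Semicomplete (D ⟨ vertices Q ⟩) ⊎ SemicompleteBipartite (D ⟨ vertices Q ⟩)) ×
      (Semicomplete (D ⟨ ∁ (vertices Q) ⟩) ⊎ SemicompleteBipartite (D ⟨ ∁ (vertices Q) ⟩) ⊎ EmptyDigraph (D ⟨ ∁ (vertices Q) ⟩))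
    conclusion with someEvenBackArc?
    ... | yes (i , d , e) = inj₁ on-P , inj₁ λ a b a≢b → outside-adjacent (off-path (proj₂ a)) (off-path (proj₂ b)) (proj₁-≢ a≢b)
      where
      full : BackwardComplete
      full = complete i d e
      open Full full
      on-P : Semicomplete (D ⟨ vertices Q ⟩)
      on-P a b a≢b with on-path (proj₂ a) | on-path (proj₂ b)
      ... | _ , l , l≤ , _ , e | _ , m , m≤ , _ , e′ = subst₂ (Adjacent D) (sym e) (sym e′)
              (complete-adjacent full l≤ m≤ λ l≡m → proj₁-≢ a≢b (trans e (trans (cong x l≡m) (sym e′))))
    ... | no noEven = inj₂ on-P , inj₂ (inj₁ off-P)
      where
      open module Bip = Bipartite noEven hiding (across)
      disjoint-colours : ∀ {z} → C 0ℙ z → C 1ℙ z → ⊥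
      disjoint-colours (l , l≤ , e₀ , e) (m , m≤ , e₁ , e′) with <-cmp l m
      ... | tri< l<m _ _    = inj l m l<m m≤ (trans (sym e) e′)
      ... | tri> _ _ m<l    = inj m l m<l l≤ (trans (sym e′) e)
      ... | tri≈ _ refl _ with trans (sym e₀) e₁
      ...   | ()
      no-coloured-arc : ∀ {γ a b} → C γ a → C γ b → ¬ Arc D a b
      no-coloured-arc (l , l≤ , e₀ , refl) (m , m≤ , e₁ , refl) r = noEven (same-parity-arc l≤ m≤ (trans e₀ (sym e₁)) r)
      0≢1 : 0ℙ ≢ 1ℙ
      0≢1 ()
      by-colour : ∀ {Q : Parity → Set} → ∃ Q → Q 0ℙ ⊎ Q 1ℙ
      by-colour (0ℙ , c) = inj₁ c
      by-colour (1ℙ , c) = inj₂ c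
      on-P : SemicompleteBipartite (D ⟨ vertices Q ⟩)
      on-P = record
        { X = C 0ℙ ∘ proj₁ ; Y = C 1ℙ ∘ proj₁
        ; cover = λ a → by-colour (on-path (proj₂ a))
        ; disjoint = λ _ (c₀ , c₁) → disjoint-colours c₀ c₁
        ; noArcX = λ _ _ → no-coloured-arc ; noArcY = λ _ _ → no-coloured-arc
        ; across = λ { _ _ (l , l≤ , e₀ , e) (m , m≤ , e₁ , e′) → subst₂ (Adjacent D) (sym e) (sym e′)
                       (opposite-parity-adjacent l≤ m≤ λ same → 0≢1 (trans (sym e₀) (trans same e₁))) } }
      off-P : SemicompleteBipartite (D ⟨ ∁ (vertices Q) ⟩)
      off-P = record
        { X = E.AdjC 0ℙ ∘ proj₁ ; Y = E.AdjC 1ℙ ∘ proj₁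
        ; cover = λ a → by-colour (coloured (off-path (proj₂ a)))
        ; disjoint = λ a (c₀ , c₁) → exclusive (off-path (proj₂ a)) c₀ c₁
        ; noArcX = λ a b → no-arc (off-path (proj₂ a)) (off-path (proj₂ b))
        ; noArcY = λ a b → no-arc (off-path (proj₂ a)) (off-path (proj₂ b))
        ; across = λ a b c₀ c₁ → Bip.across (off-path (proj₂ a)) (off-path (proj₂ b))
            (λ e → exclusive (off-path (proj₂ b)) (subst (E.AdjC 0ℙ) e c₀) c₁) c₀ c₁ }

theorem1p3 : ∀ (k : ℕ) → k % 2 ≡ 1 → 5 ≤ k →
    ∀ (n : ℕ) (D : Digraph (Fin n)) → Strong D → QuasiTransitive k D →
    ∀ (δ : ℕ ⁺) → IsDiameter D δ → [ k + 2 ] ≤⁺ δ →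
    ∀ (u v : Fin n) → IsDistance D u v [ k + 2 ] →
    ∀ (P : Path D u v) → Shortest P →
    (Semicomplete (D ⟨ vertices P ⟩) ⊎ SemicompleteBipartite (D ⟨ vertices P ⟩)) ×
    (Semicomplete (D ⟨ ∁ (vertices P) ⟩) ⊎ SemicompleteBipartite (D ⟨ ∁ (vertices P) ⟩) ⊎ EmptyDigraph (D ⟨ ∁ (vertices P) ⟩))
theorem1p3 k odd 5≤k n D strong qt δ _ _ u v (Q , length-Q , Q-shortest) P P-shortest with odd≥5 k odd 5≤k
-- `P` and the witness `Q` of the distance are both shortest, so `P` has length k + 2 as well.
... | h , refl = Main.conclusion h D strong qt P
      (trans (≤-antisym (≤-trans (P-shortest Q) (≤-reflexive length-Q)) (≤-trans (≤-reflexive (sym length-Q)) (Q-shortest P)))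
             (+-comm _ 2))
      P-shortest
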